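{- Consider the $N$-shaped matching graph with $\alpha>\beta$. The optimal control for the average cost problem is of threshold type in $(1,2)$ with priority to $(1,1)$ and $(2,2)$: there exists a decision rule of threshold type in $(1,2)$ with priority to $(1,1)$ and $(2,2)$ (for some fixed threshold $t\in\mathbb N\cup\{\infty\}$) such that the stationary policy $\pi$ using it satisfies $g^\pi(y)=g^\ast(y)$ for all $y\in\mathcal Y$.
   Context: $N$-shaped matching model. Demand nodes $\mathcal D=\{d_1,d_2\}$, supply nodes $\mathcal S=\{s_1,s_2\}$, edges $\mathcal E=\{(1,1),(1,2),(2,2)\}$, where $(i,j)$ stands for $(d_i,s_j)$; $(2,1)\notin\mathcal E$. Vectors in $\mathbb N^4$ ($\mathbb N=\{0,1,\dots\}$) are indexed by $(d_1,d_2,s_1,s_2)$, $e_k$ is the unit vector of node $k$ and $e_{(i,j)}=e_{d_i}+e_{s_j}$ for all $i,j\in\{1,2\}$. $\mathcal A=\mathcal D\times\mathcal S$ is the set of arrival pairs, $(i,j)$ being identified with $e_{(i,j)}$. Arrivals are i.i.d., distributed as $A$, with independent demand and supply: the demand item is $d_1$ with probability $\alpha$, $d_2$ with probability $1-\alpha$, the supply item is $s_1$ with probability $\beta$, $s_2$ with probability $1-\beta$, where $\alpha,\beta\in(0,1)$ and $\alpha>\beta$ (stability). States: $\mathcal Q=\{q\in\mathbb N^{4}:q_{d_1}+q_{d_2}=q_{s_1}+q_{s_2}\}$, $\mathcal Y=\mathcal Q\times\mathcal A$. For $x\in\mathcal Q$, $U_x$ is the set of $u=u_{(1,1)}e_{(1,1)}+u_{(1,2)}e_{(1,2)}+u_{(2,2)}e_{(2,2)}$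 with $u_{(i,j)}\in\mathbb N$, $u_{(1,1)}+u_{(1,2)}\le x_{d_1}$, $u_{(2,2)}\le x_{d_2}$, $u_{(1,1)}\le x_{s_1}$, $u_{(1,2)}+u_{(2,2)}\le x_{s_2}$. Dynamics and costs: a decision rule maps each $x\in\mathcal Q$ to some $u_x\in U_x$. A policy $\pi$ is a sequence of decision rules; it is stationary if the same rule is used at all times. $Y(n)=(Q(n),A(n))$, $X(n)=Q(n)+A(n)$, $Q(n+1)=X(n)-u$ with $u\in U_{X(n)}$ chosen by the rule used at time $n$; $Y(0)=y$. The cost in $y=(q,a)$ is $c(y)=c(x)=\sum_kc_kx_k$, $x=q+a$, with all $c_k>0$. $g^\pi(y)=\limsup_{N\to\infty}\frac1N\sum_{n=0}^{N-1}\mathbb E_y^\pi[c(Y(n))]$, $g^\ast(y)=\inf_\pi g^\pi(y)$ over all policies. Threshold type: a decision rule is of threshold type in $(1,2)$ with priority to $(1,1)$ and $(2,2)$ if for some $t\in\mathbb N\cup\{\infty\}$, for all $x$, $u_x=\min(x_{d_1},x_{s_1})e_{(1,1)}+\min(x_{d_2},x_{s_2})e_{(2,2)}+k_t(x)e_{(1,2)}$, where $k_t(x)=0$ if $x_{d_1}-x_{s_1}\le t$ and $k_t(x)=x_{d_1}-x_{s_1}-t$ otherwise. -}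

module Defs where

open import Algebra.Bundles using (CommutativeRing)
import Algebra.Definitions.RawMonoid as RawMonoidDefs
open import Algebra.Structures using (IsCommutativeRing)
open import Axiom.ExcludedMiddle using (ExcludedMiddle)
open import Data.Empty using (⊥-elim)
open import Data.Fin.Base using (toℕ)
open import Data.Nat.Base as ℕ using (ℕ; zero; suc)
import Data.Nat.Properties as ℕₚ
open import Data.Product.Base using (_×_; _,_; ∃; proj₁; proj₂)
open import Data.Sum.Base using (_⊎_; inj₁; inj₂)
open import Data.Vec.Base using (Vec; []; _∷_)
open import Level using (0ℓ)
open import Relation.Binary.Core using (Rel)
import Relation.Binary.Construct.Add.Extrema.Equality as ExtremaEquality
import Relation.Binary.Construct.Add.Extrema.NonStrict as ExtremaOrder
import Relation.Binary.Construct.Add.Supremum.NonStrict as Supremum≤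
import Relation.Binary.Construct.NonStrictToStrict as ToStrict
open import Relation.Binary.PropositionalEquality
  using (_≡_; refl; sym; trans; cong; cong₂; module ≡-Reasoning)
open import Relation.Binary.Structures using (IsTotalOrder)
open import Relation.Nullary.Construct.Add.Extrema using (_±; ⊥±; ⊤±; [_])
open import Relation.Nullary.Construct.Add.Supremum as Supremum using (_⁺; ⊤⁺)
open import Relation.Nullary.Decidable.Core using (yes; no)
open import Relation.Nullary.Negation.Core using (¬_)

------------------------------------------------------------------------
-- The real numbers, axiomatically: a Dedekind-complete totally ordered
-- field, which is unique up to isomorphism in classical logic.

record RealField : Set₁ where
  infixl 7 _*_
  infixl 6 _+_
  infix  8 -_
  infix  9 _⁻¹
  infix  4 _≈_ _≤_
  field
    Carrier : Set
    _≈_     : Rel Carrier 0ℓ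
    _≤_     : Rel Carrier 0ℓ
    _+_ _*_ : Carrier → Carrier → Carrier
    -_      : Carrier → Carrier
    0# 1#   : Carrier
    -- Total; its value at 0# is unspecified.
    _⁻¹     : Carrier → Carrier

    isCommutativeRing : IsCommutativeRing _≈_ _+_ _*_ -_ 0# 1#
    ⁻¹-cong           : ∀ {x y} → x ≈ y → x ⁻¹ ≈ y ⁻¹
    *-inverseʳ        : ∀ {x} → ¬ (x ≈ 0#) → x * x ⁻¹ ≈ 1#
    0≉1               : ¬ (0# ≈ 1#)

    isTotalOrder : IsTotalOrder _≈_ _≤_
    +-monoʳ-≤    : ∀ x {y z} → y ≤ z → x + y ≤ x + z
    *-nonneg     : ∀ {x y} → 0# ≤ x → 0# ≤ y → 0# ≤ x * y

    complete : (P : Carrier → Set) → ∃ P → (∃ λ b → ∀ x → P x → x ≤ b) →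
               ∃ λ s → (∀ x → P x → x ≤ s) ×
                       (∀ b → (∀ x → P x → x ≤ b) → s ≤ b)

  commutativeRing : CommutativeRing 0ℓ 0ℓ
  commutativeRing = record { isCommutativeRing = isCommutativeRing }

  open CommutativeRing commutativeRing public
    using (_-_; +-rawMonoid)
  open RawMonoidDefs +-rawMonoid public
    using (sum) renaming (_×_ to infixr 8 _·_)
  open ToStrict _≈_ _≤_ public using (_<_)

------------------------------------------------------------------------
-- Excluded middle makes suprema and infima of extended reals total, so
-- that limsup, and the infimum over policies below, are functions.

module ExtendedReals (em : ExcludedMiddle 0ℓ) (ℝ : RealField) where
  open RealField ℝ
  open ExtremaEquality _≈_ public using (_≈±_)
  open module ≤± = ExtremaOrder _≤_ public using (_≤±_)

  ℝ± : Set
  ℝ± = Carrier ±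

  IsUpperBound IsLowerBound IsSup IsInf : (ℝ± → Set) → ℝ± → Set
  IsUpperBound P b = ∀ v → P v → v ≤± b
  IsLowerBound P b = ∀ v → P v → b ≤± v
  IsSup P s = IsUpperBound P s × (∀ b → IsUpperBound P b → s ≤± b)
  IsInf P i = IsLowerBound P i × (∀ b → IsLowerBound P b → b ≤± i)

  [x]≰⊥ : ∀ {x} → ¬ ([ x ] ≤± ⊥±)
  [x]≰⊥ Supremum≤.[ () ]

  sup-exists : (P : ℝ± → Set) → ∃ (IsSup P)
  sup-exists P with em {P ⊤±}
  ... | yes p⊤ = ⊤± , (λ v _ → v ≤±.≤⊤±) , (λ b ub → ub ⊤± p⊤)
  ... | no ¬p⊤ with em {∃ λ x → P [ x ]}
  ...   | no ¬p = ⊥± , ub , (λ b _ → ≤±.⊥±≤ b)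
    where
    ub : IsUpperBound P ⊥±
    ub ⊥±    _  = ≤±.⊥±≤⊥±
    ub [ x ] px = ⊥-elim (¬p (x , px))
    ub ⊤±    p⊤ = ⊥-elim (¬p⊤ p⊤)
  ...   | yes (x₀ , px₀) with em {∃ λ b → ∀ x → P [ x ] → x ≤ b}
  ...     | no ¬bd = ⊤± , (λ v _ → v ≤±.≤⊤±) , least
    where
    least : ∀ b → IsUpperBound P b → ⊤± ≤± b
    least ⊥±    ub = ⊥-elim ([x]≰⊥ (ub [ x₀ ] px₀))
    least [ b ] ub = ⊥-elim (¬bd (b , λ x px → ≤±.[≤]-injective (ub [ x ] px)))
    least ⊤±    ub = ≤±.⊤±≤⊤±
  ...     | yes bd with complete (λ x → P [ x ]) (x₀ , px₀) bd
  ...       | s , s-ub , s-least = [ s ] , ub , least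
    where
    ub : IsUpperBound P [ s ]
    ub ⊥±    _  = ≤±.⊥±≤[ s ]
    ub [ x ] px = ≤±.[ s-ub x px ]
    ub ⊤±    p⊤ = ⊥-elim (¬p⊤ p⊤)
    least : ∀ b → IsUpperBound P b → [ s ] ≤± b
    least ⊥±    b-ub = ⊥-elim ([x]≰⊥ (b-ub [ x₀ ] px₀))
    least [ b ] b-ub =
      ≤±.[ s-least b (λ x px → ≤±.[≤]-injective (b-ub [ x ] px)) ]
    least ⊤±    b-ub = ≤±.[ s ]≤⊤±

  inf-exists : (P : ℝ± → Set) → ∃ (IsInf P)
  inf-exists P with sup-exists (IsLowerBound P)
  ... | i , i-ub , i-least =
    i , (λ v pv → i-least v (λ b lb → lb v pv)) , i-ub

  sup inf : (ℝ± → Set) → ℝ±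
  sup P = proj₁ (sup-exists P)
  inf P = proj₁ (inf-exists P)

  limsup : (ℕ → Carrier) → ℝ±
  limsup a = inf λ v → ∃ λ n → v ≡ sup λ w → ∃ λ k → n ℕ.≤ k × w ≡ [ a k ]

------------------------------------------------------------------------
-- The N-shaped matching model: the edges are all pairs except (d₂ , s₁).

data Demand : Set where
  d₁ d₂ : Demand

data Supply : Set where
  s₁ s₂ : Supply

Node : Set
Node = Demand ⊎ Supply

pattern D₁ = inj₁ d₁
pattern D₂ = inj₁ d₂
pattern S₁ = inj₂ s₁
pattern S₂ = inj₂ s₂

-- A record rather than Node → ℕ, so that _≡_ on states (hence on the
-- arguments of decision rules) is extensional.
record ℕ⁴ : Set where
  constructor vec
  field
    x-d₁ x-d₂ x-s₁ x-s₂ : ℕ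

_at_ : ℕ⁴ → Node → ℕ
vec a b c d at D₁ = a
vec a b c d at D₂ = b
vec a b c d at S₁ = c
vec a b c d at S₂ = d

infixl 6 _⊕_ _⊖_

_⊕_ : ℕ⁴ → ℕ⁴ → ℕ⁴
vec a b c d ⊕ vec a′ b′ c′ d′ = vec (a ℕ.+ a′) (b ℕ.+ b′) (c ℕ.+ c′) (d ℕ.+ d′)

-- Truncated; only applied when the subtrahend is componentwise smaller.
_⊖_ : ℕ⁴ → ℕ⁴ → ℕ⁴
vec a b c d ⊖ vec a′ b′ c′ d′ = vec (a ℕ.∸ a′) (b ℕ.∸ b′) (c ℕ.∸ c′) (d ℕ.∸ d′)

e : Node → ℕ⁴
e D₁ = vec 1 0 0 0
e D₂ = vec 0 1 0 0
e S₁ = vec 0 0 1 0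
e S₂ = vec 0 0 0 1

Arrival : Set
Arrival = Demand × Supply

e₍_₎ : Arrival → ℕ⁴
e₍ i , j ₎ = e (inj₁ i) ⊕ e (inj₂ j)

Balanced : ℕ⁴ → Set
Balanced x = x at D₁ ℕ.+ x at D₂ ≡ x at S₁ ℕ.+ x at S₂

record 𝒬 : Set where
  constructor state
  field
    counts    : ℕ⁴
    .balanced : Balanced counts

open 𝒬 public

𝒴 : Set
𝒴 = 𝒬 × Arrival

-- The coefficients of a matching on the three edges.
record Matching : Set where
  constructor matching
  field
    u₁₁ u₁₂ u₂₂ : ℕ

-- u₁₁ e₍₁,₁₎ + u₁₂ e₍₁,₂₎ + u₂₂ e₍₂,₂₎
⟦_⟧ : Matching → ℕ⁴
⟦ matching u₁₁ u₁₂ u₂₂ ⟧ = vec (u₁₁ ℕ.+ u₁₂) u₂₂ u₁₁ (u₁₂ ℕ.+ u₂₂)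

infix 4 _∈U_

_∈U_ : Matching → 𝒬 → Set
matching u₁₁ u₁₂ u₂₂ ∈U state x _ =
  u₁₁ ℕ.+ u₁₂ ℕ.≤ x at D₁ × u₂₂ ℕ.≤ x at D₂ ×
  u₁₁ ℕ.≤ x at S₁ × u₁₂ ℕ.+ u₂₂ ℕ.≤ x at S₂

record DecisionRule : Set where
  field
    rule     : 𝒬 → Matching
    feasible : ∀ x → rule x ∈U x

open DecisionRule public

Policy : Set
Policy = ℕ → DecisionRule

stationary : DecisionRule → Policy
stationary δ _ = δ

private
  open ≡-Reasoning

  +-interchange : ∀ a b c d → (a ℕ.+ b) ℕ.+ (c ℕ.+ d) ≡ (a ℕ.+ c) ℕ.+ (b ℕ.+ d)
  +-interchange a b c d = begin
    (a ℕ.+ b) ℕ.+ (c ℕ.+ d) ≡⟨ ℕₚ.+-assoc a b (c ℕ.+ d) ⟩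
    a ℕ.+ (b ℕ.+ (c ℕ.+ d)) ≡⟨ cong (a ℕ.+_) (sym (ℕₚ.+-assoc b c d)) ⟩
    a ℕ.+ ((b ℕ.+ c) ℕ.+ d) ≡⟨ cong (λ z → a ℕ.+ (z ℕ.+ d)) (ℕₚ.+-comm b c) ⟩
    a ℕ.+ ((c ℕ.+ b) ℕ.+ d) ≡⟨ cong (a ℕ.+_) (ℕₚ.+-assoc c b d) ⟩
    a ℕ.+ (c ℕ.+ (b ℕ.+ d)) ≡⟨ sym (ℕₚ.+-assoc a c (b ℕ.+ d)) ⟩
    (a ℕ.+ c) ℕ.+ (b ℕ.+ d) ∎

  ∸-interchange : ∀ {a b c d} → c ℕ.≤ a → d ℕ.≤ b →
                  (a ℕ.∸ c) ℕ.+ (b ℕ.∸ d) ℕ.+ (c ℕ.+ d) ≡ a ℕ.+ b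
  ∸-interchange {a} {b} {c} {d} c≤a d≤b = begin
    (a ℕ.∸ c) ℕ.+ (b ℕ.∸ d) ℕ.+ (c ℕ.+ d)   ≡⟨ +-interchange (a ℕ.∸ c) (b ℕ.∸ d) c d ⟩
    (a ℕ.∸ c ℕ.+ c) ℕ.+ (b ℕ.∸ d ℕ.+ d)     ≡⟨ cong₂ ℕ._+_ (ℕₚ.m∸n+n≡m c≤a) (ℕₚ.m∸n+n≡m d≤b) ⟩
    a ℕ.+ b                                 ∎

⊕-balanced : ∀ x y → Balanced x → Balanced y → Balanced (x ⊕ y)
⊕-balanced (vec a b c d) (vec a′ b′ c′ d′) p q =
  trans (+-interchange a a′ b b′)
    (trans (cong₂ ℕ._+_ p q) (+-interchange c d c′ d′))

e-balanced : ∀ a → Balanced e₍ a ₎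
e-balanced (d₁ , s₁) = refl
e-balanced (d₁ , s₂) = refl
e-balanced (d₂ , s₁) = refl
e-balanced (d₂ , s₂) = refl

⊖-balanced : ∀ x u → Balanced (counts x) → u ∈U x →
             Balanced (counts x ⊖ ⟦ u ⟧)
⊖-balanced (state (vec a b c d) _) (matching u₁₁ u₁₂ u₂₂) p (h₁ , h₂ , h₃ , h₄) =
  ℕₚ.+-cancelʳ-≡ (u₁₁ ℕ.+ u₁₂ ℕ.+ u₂₂) _ _ (begin
    _       ≡⟨ ∸-interchange h₁ h₂ ⟩
    a ℕ.+ b ≡⟨ p ⟩
    c ℕ.+ d ≡⟨ sym (∸-interchange h₃ h₄) ⟩
    (c ℕ.∸ u₁₁) ℕ.+ (d ℕ.∸ (u₁₂ ℕ.+ u₂₂)) ℕ.+ (u₁₁ ℕ.+ (u₁₂ ℕ.+ u₂₂))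
            ≡⟨ cong ((c ℕ.∸ u₁₁) ℕ.+ (d ℕ.∸ (u₁₂ ℕ.+ u₂₂)) ℕ.+_)
                    (sym (ℕₚ.+-assoc u₁₁ u₁₂ u₂₂)) ⟩
    _       ∎)

_+ᵃ_ : 𝒬 → Arrival → 𝒬
state q b +ᵃ a = state (q ⊕ e₍ a ₎) (⊕-balanced q e₍ a ₎ b (e-balanced a))

match : DecisionRule → 𝒬 → 𝒬
match δ x@(state q b) =
  state (q ⊖ ⟦ rule δ x ⟧) (⊖-balanced x (rule δ x) b (feasible δ x))

step : DecisionRule → 𝒴 → Arrival → 𝒴
step δ (q , a) a′ = match δ (q +ᵃ a) , a′

-- Y(n) as a function of the arrivals A(n), …, A(1), listed latest first.
Y : Policy → 𝒴 → (n : ℕ) → Vec Arrival n → 𝒴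
Y π y zero    []       = y
Y π y (suc n) (a ∷ as) = step (π n) (Y π y n as) a

-- The amount matched on (d₁ , s₂) for a threshold t in ℕ ∪ {∞}, ⊤⁺ being ∞.
-- Truncated subtraction makes the excess 0 when x_{d₁} - x_{s₁} ≤ t.
excess : ℕ ⁺ → ℕ⁴ → ℕ
excess Supremum.[ t ] x = x at D₁ ℕ.∸ x at S₁ ℕ.∸ t
excess ⊤⁺             x = 0

IsThreshold : DecisionRule → Set
IsThreshold δ = ∃ λ t → ∀ x → let v = counts x in
  rule δ x ≡ matching (v at D₁ ℕ.⊓ v at S₁) (excess t v) (v at D₂ ℕ.⊓ v at S₂)

module AverageCost
  (em : ExcludedMiddle 0ℓ) (ℝ : RealField)
  (α β : RealField.Carrier ℝ) (c : Node → RealField.Carrier ℝ)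
  where

  open RealField ℝ
  open ExtendedReals em ℝ public

  Pr : Arrival → Carrier
  Pr (i , j) = demand i * supply j
    where
    demand : Demand → Carrier
    demand d₁ = α
    demand d₂ = 1# - α
    supply : Supply → Carrier
    supply s₁ = β
    supply s₂ = 1# - β

  -- Expectation over n independent arrivals.
  𝔼 : ∀ n → (Vec Arrival n → Carrier) → Carrier
  𝔼 zero    f = f []
  𝔼 (suc n) f = term (d₁ , s₁) + term (d₁ , s₂) + term (d₂ , s₁) + term (d₂ , s₂)
    where
    term : Arrival → Carrier
    term a = Pr a * 𝔼 n (λ as → f (a ∷ as))

  cost : 𝒴 → Carrier
  cost (q , a) = let x = counts (q +ᵃ a) in
    (x at D₁) · c D₁ + (x at D₂) · c D₂ + (x at S₁) · c S₁ + (x at S₂) · c S₂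

  -- The average over the first 1 + n periods.
  average : Policy → 𝒴 → ℕ → Carrier
  average π y n =
    (suc n · 1#) ⁻¹ * sum {suc n} (λ k → 𝔼 (toℕ k) (λ as → cost (Y π y (toℕ k) as)))

  g : Policy → 𝒴 → ℝ±
  g π y = limsup (average π y)

  g* : 𝒴 → ℝ±
  g* y = inf λ v → ∃ λ π → v ≡ g π y

{-# OPTIONS --safe #-}

-- Write z = x_{d₁} - x_{s₁}, p = α(1 - β), r = (1 - α)β. Matching on (1,1) and (2,2) fixes z and
-- matching on (1,2) lowers it; arrivals raise z with probability p and lower it with probability
-- r < p; and z bounds the cost of a state from below, with equality after the matchings prescribed
-- by a threshold. For the best threshold t, with cost γ, the relative value function V increases
-- with the distance of z below t and is nonnegative, so summing its Poisson equation shows that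
-- the threshold policy costs at most γ. V itself grows quadratically and so does not yield the
-- lower bound for all policies. But for each δ > 0 there is a bounded potential W, monotone in
-- that distance, which satisfies the drift inequality with γ - δ in place of γ; by monotonicity
-- the inequality survives every feasible decision, and summing it shows that every policy costs
-- at least γ - δ.

module Submission where

open import Defs
import Algebra.Construct.NaturalChoice.Max as NaturalChoice
import Algebra.Properties.AbelianGroup as AbelianGroupProperties
import Algebra.Properties.CommutativeMonoid.Mult as CommutativeMonoidMult
import Algebra.Properties.Ring as RingProperties
import Algebra.Properties.Semiring.Mult as Mult
import Algebra.Properties.Semiring.Mult.TCOptimised as TCOptimisedMult
import Algebra.Solver.Ring as RingSolver
open import Algebra.Bundles using (CommutativeRing)
open import Algebra.Solver.Ring.AlmostCommutativeRing
  using (fromCommutativeRing; _-Raw-AlmostCommutative⟶_)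
open import Axiom.ExcludedMiddle using (ExcludedMiddle)
open import Data.Empty using (⊥; ⊥-elim)
open import Data.Fin.Base using (toℕ)
open import Data.Integer.Base as ℤ using (ℤ; +_; -[1+_])
import Data.Integer.Properties as ℤₚ
open import Data.Maybe.Base using (Maybe; just; nothing)
open import Data.Nat.Base as ℕ using (ℕ; zero; suc; pred)
import Data.Nat.Properties as ℕₚ
open import Data.Product.Base using (_×_; _,_; ∃; proj₁; proj₂)
import Data.Sign.Base as Sign
open import Data.Sum.Base using (_⊎_; inj₁; inj₂)
open import Data.Vec.Base using (Vec; []; _∷_)
open import Level using (0ℓ)
open import Relation.Binary.Bundles using (Poset; TotalOrder)
open import Relation.Binary.PropositionalEquality as ≡ using (_≡_)
import Relation.Binary.Reasoning.PartialOrder as ≤-Reasoning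
import Relation.Binary.Reasoning.Setoid as SetoidReasoning
open import Relation.Binary.Structures using (IsTotalOrder)
open import Relation.Nullary.Construct.Add.Extrema using (⊥±; ⊤±; [_])
import Relation.Nullary.Construct.Add.Supremum as Supremum
open import Relation.Nullary.Decidable using (recompute)
open import Relation.Nullary.Decidable.Core using (yes; no)
open import Relation.Nullary.Negation.Core using (¬_)

-- `P` and `Q` may overlap, like the two sides of a total order; the `t` found is the first index at
-- which the given disjunction chooses `P`.
search : {P Q : ℕ → Set} → (∀ n → P n ⊎ Q n) → ∀ n →
         (∃ λ t → P t × ∀ i → i ℕ.< t → Q i) ⊎ (∀ i → i ℕ.< n → Q i)
search P⊎Q zero = inj₂ λ _ ()
search {P} {Q} P⊎Q (suc n) with search {P} {Q} P⊎Q n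
... | inj₁ found = inj₁ found
... | inj₂ below with P⊎Q n
...   | inj₁ Pn = inj₁ (n , Pn , below)
...   | inj₂ Qn = inj₂ λ i i<1+n → case-< (ℕₚ.m<1+n⇒m<n∨m≡n i<1+n)
  where
  case-< : ∀ {i} → i ℕ.< n ⊎ i ≡ n → Q i
  case-< (inj₁ i<n)    = below _ i<n
  case-< (inj₂ ≡.refl) = Qn

-- A ring solver with integer coefficients.

-- Coefficients in ℤ, whose equality is decidable, let the solver cancel terms.
module IntegerCoefficients {c ℓ} (R : CommutativeRing c ℓ) where
  open CommutativeRing R
  open TCOptimisedMult semiring using (×-homo-+; ×1-homo-*; 1+×) renaming (_×_ to infixl 8 _·_)
  open RingProperties ring
  open AbelianGroupProperties +-abelianGroup using (⁻¹-∙-comm)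
  open SetoidReasoning setoid

  -- With the optimised multiple, `1 · 1#` reduces to `1#`, so `con (+ 1)` denotes `1#` by
  -- computation.
  fromℤ : ℤ → Carrier
  fromℤ (+ n)    = n · 1#
  fromℤ -[1+ n ] = - (suc n · 1#)

  neg-homo : ∀ i → fromℤ (ℤ.- i) ≈ - fromℤ i
  neg-homo (+ zero)    = sym -0#≈0#
  neg-homo (+ suc n)   = refl
  neg-homo -[1+ n ]    = sym (-‿involutive _)

  ⊖-homo : ∀ m n → fromℤ (m ℤ.⊖ n) ≈ m · 1# - n · 1#
  ⊖-homo m zero = sym (trans (+-congˡ -0#≈0#) (+-identityʳ _))
  ⊖-homo zero (suc n) = sym (+-identityˡ _)
  ⊖-homo (suc m) (suc n) = begin
    fromℤ (suc m ℤ.⊖ suc n)         ≡⟨ ≡.cong fromℤ (ℤₚ.[1+m]⊖[1+n]≡m⊖n m n) ⟩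
    fromℤ (m ℤ.⊖ n)                 ≈⟨ ⊖-homo m n ⟩
    x - y                       ≈⟨ +-congʳ (+-identityˡ x) ⟨
    (0# + x) - y                ≈⟨ +-congʳ (+-congʳ (-‿inverseʳ 1#)) ⟨
    ((1# - 1#) + x) - y         ≈⟨ +-congʳ (+-assoc _ _ _) ⟩
    (1# + (- 1# + x)) - y       ≈⟨ +-congʳ (+-congˡ (+-comm _ _)) ⟩
    (1# + (x - 1#)) - y         ≈⟨ +-congʳ (+-assoc _ _ _) ⟨
    ((1# + x) - 1#) - y         ≈⟨ +-assoc _ _ _ ⟩
    (1# + x) + (- 1# - y)       ≈⟨ +-congˡ (⁻¹-∙-comm 1# y) ⟩
    (1# + x) - (1# + y)         ≈⟨ +-cong (1+× m 1#) (-‿cong (1+× n 1#)) ⟨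
    suc m · 1# - suc n · 1#     ∎
    where x = m · 1# ; y = n · 1#

  +-homo : ∀ i j → fromℤ (i ℤ.+ j) ≈ fromℤ i + fromℤ j
  +-homo (+ m)    (+ n)    = ×-homo-+ 1# m n
  +-homo (+ m)    -[1+ n ] = ⊖-homo m (suc n)
  +-homo -[1+ m ] (+ n)    = trans (⊖-homo n (suc m)) (+-comm _ _)
  +-homo -[1+ m ] -[1+ n ] = begin
    - (suc (suc (m ℕ.+ n)) · 1#)  ≡⟨ ≡.cong (λ k → - (k · 1#)) (≡.cong suc (ℕₚ.+-suc m n)) ⟨
    - ((suc m ℕ.+ suc n) · 1#)    ≈⟨ -‿cong (×-homo-+ 1# (suc m) (suc n)) ⟩
    - (suc m · 1# + suc n · 1#)   ≈⟨ ⁻¹-∙-comm _ _ ⟨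
    - (suc m · 1#) - (suc n · 1#) ∎

  -- Integer products are formed from sign and absolute value, and `◃` computes only once the
  -- absolute value is known to be zero or a successor.
  +◃-homo : ∀ n → fromℤ (Sign.+ ℤ.◃ n) ≈ n · 1#
  +◃-homo zero    = refl
  +◃-homo (suc n) = refl

  -◃-homo : ∀ n → fromℤ (Sign.- ℤ.◃ n) ≈ - (n · 1#)
  -◃-homo zero    = sym -0#≈0#
  -◃-homo (suc n) = refl

  *-homo : ∀ i j → fromℤ (i ℤ.* j) ≈ fromℤ i * fromℤ j
  *-homo (+ m)    (+ n)    = trans (+◃-homo (m ℕ.* n)) (×1-homo-* m n)
  *-homo (+ m)    -[1+ n ] =
    trans (-◃-homo (m ℕ.* suc n)) (trans (-‿cong (×1-homo-* m (suc n))) (-‿distribʳ-* _ _))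
  *-homo -[1+ m ] (+ n)    =
    trans (-◃-homo (suc m ℕ.* n)) (trans (-‿cong (×1-homo-* (suc m) n)) (-‿distribˡ-* _ _))
  *-homo -[1+ m ] -[1+ n ] = begin
    fromℤ (Sign.+ ℤ.◃ (suc m ℕ.* suc n))   ≈⟨ +◃-homo (suc m ℕ.* suc n) ⟩
    (suc m ℕ.* suc n) · 1#             ≈⟨ ×1-homo-* (suc m) (suc n) ⟩
    (suc m · 1#) * (suc n · 1#)        ≈⟨ -‿involutive _ ⟨
    - - ((suc m · 1#) * (suc n · 1#))  ≈⟨ -‿cong (-‿distribˡ-* _ _) ⟩
    - (- (suc m · 1#) * (suc n · 1#))  ≈⟨ -‿distribʳ-* _ _ ⟩
    - (suc m · 1#) * - (suc n · 1#)    ∎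

  homomorphism : ℤ.+-*-rawRing -Raw-AlmostCommutative⟶ fromCommutativeRing R
  homomorphism = record
    { ⟦_⟧ = fromℤ ; +-homo = +-homo ; *-homo = *-homo ; -‿homo = neg-homo
    ; 0-homo = refl ; 1-homo = refl }

  _coeff≟_ : ∀ i j → Maybe (fromℤ i ≈ fromℤ j)
  i coeff≟ j with i ℤₚ.≟ j
  ... | yes i≡j = just (reflexive (≡.cong fromℤ i≡j))
  ... | no  _   = nothing

  open RingSolver ℤ.+-*-rawRing (fromCommutativeRing R) homomorphism _coeff≟_ public
    using (solve; _:=_; _:+_; _:*_; _:-_; :-_; con)

-- Arithmetic of ordered fields.

module OrderedField (ℝ : RealField) where
  open RealField ℝ public hiding (_≈_)
  open CommutativeRing commutativeRing public
    using (_≈_; refl; sym; trans; semiring; +-cong; +-congˡ; +-congʳ; *-congˡ; *-congʳ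
          ; -‿cong; +-identityˡ; +-identityʳ; +-comm; *-identityˡ; zeroʳ)
  open IntegerCoefficients commutativeRing public
    using (solve; _:=_; _:+_; _:*_; _:-_; :-_; con)
  open Mult semiring public
    using (×-homo-+; ×-assoc-*; ×-congˡ)
  open IsTotalOrder isTotalOrder public
    using (total; antisym; isPartialOrder)
    renaming (reflexive to ≤-reflexive; trans to ≤-trans; refl to ≤-refl)

  poset : Poset 0ℓ 0ℓ 0ℓ
  poset = record { isPartialOrder = isPartialOrder }

  totalOrder : TotalOrder 0ℓ 0ℓ 0ℓ
  totalOrder = record { isTotalOrder = isTotalOrder }

  open ≤-Reasoning poset public
  open NaturalChoice totalOrder public using (_⊔_; x≤x⊔y; x≤y⊔x; ⊔-lub; ⊔-sel)

  +-mono-≤ : ∀ {x y u v} → x ≤ y → u ≤ v → x + u ≤ y + v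
  +-mono-≤ {x} {y} {u} {v} x≤y u≤v = begin
    x + u ≤⟨ +-monoʳ-≤ x u≤v ⟩
    x + v ≈⟨ +-comm x v ⟩
    v + x ≤⟨ +-monoʳ-≤ v x≤y ⟩
    v + y ≈⟨ +-comm v y ⟩
    y + v ∎

  +-nonneg : ∀ {x y} → 0# ≤ x → 0# ≤ y → 0# ≤ x + y
  +-nonneg 0≤x 0≤y = ≤-trans (≤-reflexive (sym (+-identityˡ 0#))) (+-mono-≤ 0≤x 0≤y)

  x≤x+y : ∀ {x y} → 0# ≤ y → x ≤ x + y
  x≤x+y {x} 0≤y = ≤-trans (≤-reflexive (sym (+-identityʳ x))) (+-monoʳ-≤ x 0≤y)

  x≤y+x : ∀ {x y} → 0# ≤ y → x ≤ y + x
  x≤y+x 0≤y = ≤-trans (x≤x+y 0≤y) (≤-reflexive (+-comm _ _))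

  x≤y⇒0≤y-x : ∀ {x y} → x ≤ y → 0# ≤ y - x
  x≤y⇒0≤y-x {x} {y} x≤y = begin
    0#      ≈⟨ solve 1 (λ x → con (+ 0) := :- x :+ x) refl x ⟩
    - x + x ≤⟨ +-monoʳ-≤ (- x) x≤y ⟩
    - x + y ≈⟨ +-comm _ _ ⟩
    y - x   ∎

  0≤y-x⇒x≤y : ∀ {x y} → 0# ≤ y - x → x ≤ y
  0≤y-x⇒x≤y {x} {y} 0≤y-x = begin
    x           ≤⟨ x≤x+y 0≤y-x ⟩
    x + (y - x) ≈⟨ solve 2 (λ x y → x :+ (y :- x) := y) refl x y ⟩
    y           ∎

  +-cancelˡ-≤ : ∀ z {x y} → z + x ≤ z + y → x ≤ y
  +-cancelˡ-≤ z {x} {y} le = 0≤y-x⇒x≤y (begin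
    0#                ≤⟨ x≤y⇒0≤y-x le ⟩
    (z + y) - (z + x) ≈⟨ solve 3 (λ x y z → (z :+ y) :- (z :+ x) := y :- x) refl x y z ⟩
    y - x             ∎)

  -- The solver proves equations only; an inequality reaches it as an equation with an explicit
  -- nonnegative slack `s`.
  ≤-by-gap : ∀ {x y s} → 0# ≤ s → y ≈ x + s → x ≤ y
  ≤-by-gap 0≤s y≈x+s = ≤-trans (x≤x+y 0≤s) (≤-reflexive (sym y≈x+s))

  *-monoʳ-≤ : ∀ {z x y} → 0# ≤ z → x ≤ y → z * x ≤ z * y
  *-monoʳ-≤ {z} {x} {y} 0≤z x≤y =
    ≤-by-gap (*-nonneg 0≤z (x≤y⇒0≤y-x x≤y))
      (solve 3 (λ x y z → z :* y := z :* x :+ z :* (y :- x)) refl x y z)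

  0≤1 : 0# ≤ 1#
  0≤1 with total 0# 1#
  ... | inj₁ 0≤1 = 0≤1
  ... | inj₂ 1≤0 = ≤-trans (*-nonneg 0≤-1 0≤-1)
                     (≤-reflexive (solve 0 (:- con (+ 1) :* :- con (+ 1) := con (+ 1)) refl))
    where
    0≤-1 : 0# ≤ - 1#
    0≤-1 = ≤-trans (x≤y⇒0≤y-x 1≤0) (≤-reflexive (+-identityˡ _))

  0<1 : 0# < 1#
  0<1 = 0≤1 , 0≉1

  <⇒≱ : ∀ {x y} → x < y → ¬ (y ≤ x)
  <⇒≱ (x≤y , x≉y) y≤x = x≉y (antisym x≤y y≤x)

  0<y-x : ∀ {x y} → x < y → 0# < y - x
  0<y-x {x} {y} (x≤y , x≉y) = x≤y⇒0≤y-x x≤y , λ 0≈y-x → x≉y (begin-equality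
    x           ≈⟨ +-identityʳ x ⟨
    x + 0#      ≈⟨ +-congˡ 0≈y-x ⟩
    x + (y - x) ≈⟨ solve 2 (λ x y → x :+ (y :- x) := y) refl x y ⟩
    y           ∎)

  0≤x⇒0<y⇒0<x+y : ∀ {x y} → 0# ≤ x → 0# < y → 0# < x + y
  0≤x⇒0<y⇒0<x+y 0≤x 0<y =
    +-nonneg 0≤x (proj₁ 0<y) , λ 0≈x+y → <⇒≱ 0<y (≤-trans (x≤y+x 0≤x) (≤-reflexive (sym 0≈x+y)))

  module _ {x} (0<x : 0# < x) where
    x*x⁻¹≈1 : x * x ⁻¹ ≈ 1#
    x*x⁻¹≈1 = *-inverseʳ (λ x≈0 → proj₂ 0<x (sym x≈0))

    0≤x⁻¹ : 0# ≤ x ⁻¹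
    0≤x⁻¹ with total 0# (x ⁻¹)
    ... | inj₁ 0≤x⁻¹ = 0≤x⁻¹
    ... | inj₂ x⁻¹≤0 = ⊥-elim (<⇒≱ 0<1 (begin
      1#                ≈⟨ x*x⁻¹≈1 ⟨
      x * x ⁻¹          ≤⟨ *-monoʳ-≤ (proj₁ 0<x) x⁻¹≤0 ⟩
      x * 0#            ≈⟨ zeroʳ x ⟩
      0#                ∎))

    x*[x⁻¹*y]≈y : ∀ y → x * (x ⁻¹ * y) ≈ y
    x*[x⁻¹*y]≈y y = begin-equality
      x * (x ⁻¹ * y) ≈⟨ solve 3 (λ x i y → x :* (i :* y) := (x :* i) :* y) refl x (x ⁻¹) y ⟩
      (x * x ⁻¹) * y ≈⟨ *-congʳ x*x⁻¹≈1 ⟩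
      1# * y         ≈⟨ *-identityˡ y ⟩
      y              ∎

    x⁻¹*[x*y]≈y : ∀ y → x ⁻¹ * (x * y) ≈ y
    x⁻¹*[x*y]≈y y = trans
      (solve 3 (λ x i y → i :* (x :* y) := x :* (i :* y)) refl x (x ⁻¹) y) (x*[x⁻¹*y]≈y y)

    *-cancelˡ-≤ : ∀ {y z} → x * y ≤ x * z → y ≤ z
    *-cancelˡ-≤ {y} {z} le = begin
      y               ≈⟨ x⁻¹*[x*y]≈y y ⟨
      x ⁻¹ * (x * y)  ≤⟨ *-monoʳ-≤ 0≤x⁻¹ le ⟩
      x ⁻¹ * (x * z)  ≈⟨ x⁻¹*[x*y]≈y z ⟩
      z               ∎

    0<x⁻¹ : 0# < x ⁻¹
    0<x⁻¹ = 0≤x⁻¹ , λ 0≈x⁻¹ → 0≉1 (begin-equality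
      0#       ≈⟨ zeroʳ x ⟨
      x * 0#   ≈⟨ *-congˡ 0≈x⁻¹ ⟩
      x * x ⁻¹ ≈⟨ x*x⁻¹≈1 ⟩
      1#       ∎)

    *-pos : ∀ {y} → 0# < y → 0# < x * y
    *-pos {y} 0<y = *-nonneg (proj₁ 0<x) (proj₁ 0<y) , λ 0≈xy → proj₂ 0<y (begin-equality
      0#             ≈⟨ zeroʳ (x ⁻¹) ⟨
      x ⁻¹ * 0#      ≈⟨ *-congˡ 0≈xy ⟩
      x ⁻¹ * (x * y) ≈⟨ x⁻¹*[x*y]≈y y ⟩
      y              ∎)

  ·-nonneg : ∀ n {x} → 0# ≤ x → 0# ≤ n · x
  ·-nonneg zero    0≤x = ≤-refl
  ·-nonneg (suc n) 0≤x = +-nonneg 0≤x (·-nonneg n 0≤x)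

  ·-monoˡ-≤ : ∀ {m n x} → 0# ≤ x → m ℕ.≤ n → m · x ≤ n · x
  ·-monoˡ-≤ {n = n} 0≤x ℕ.z≤n = ·-nonneg n 0≤x
  ·-monoˡ-≤ {x = x} 0≤x (ℕ.s≤s m≤n) = +-monoʳ-≤ x (·-monoˡ-≤ 0≤x m≤n)

  ·1-* : ∀ n x → (n · 1#) * x ≈ n · x
  ·1-* n x = trans (×-assoc-* n 1# x) (Mult.×-congʳ semiring n (*-identityˡ x))

  0<suc·1 : ∀ n → 0# < suc n · 1#
  0<suc·1 n = +-nonneg 0≤1 0≤n , λ 0≈1+n → <⇒≱ 0<1 (≤-trans (x≤x+y 0≤n) (≤-reflexive (sym 0≈1+n)))
    where 0≤n = ·-nonneg n 0≤1

  growth : ∀ {ε} (f : ℕ → Carrier) → (∀ i → f i + ε ≤ f (suc i)) → ∀ n → f 0 + n · ε ≤ f n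
  growth f grows zero = ≤-reflexive (+-identityʳ _)
  growth {ε} f grows (suc n) = begin
    f 0 + (ε + n · ε) ≈⟨ solve 3 (λ f e n → f :+ (e :+ n) := f :+ n :+ e) refl (f 0) ε (n · ε) ⟩
    f 0 + n · ε + ε   ≤⟨ +-mono-≤ (growth f grows n) ≤-refl ⟩
    f n + ε           ≤⟨ grows n ⟩
    f (suc n)         ∎

  -- The Archimedean property and its consequences.

  module _ (em : ExcludedMiddle 0ℓ) where

    -- Otherwise the multiples of `ε` have a supremum `s`. Adding `ε` to a multiple gives a
    -- multiple, so `s - ε` bounds them too, against leastness.
    archimedean : ∀ {ε} → 0# < ε → ∀ x → ∃ λ n → x ≤ n · ε
    archimedean {ε} 0<ε x with em {∃ λ n → x ≤ n · ε}
    ... | yes hit  = hit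
    ... | no  miss with complete (λ v → ∃ λ n → v ≡ n · ε) (0# , 0 , ≡.refl) (x , bounded)
      where
      bounded : ∀ v → (∃ λ n → v ≡ n · ε) → v ≤ x
      bounded v (n , ≡.refl) with total v x
      ... | inj₁ v≤x = v≤x
      ... | inj₂ x≤v = ⊥-elim (miss (n , x≤v))
    ... | s , ub , least = ⊥-elim (<⇒≱ 0<ε (+-cancelˡ-≤ s (begin
        s + ε       ≤⟨ +-mono-≤ (least (s - ε) below) ≤-refl ⟩
        (s - ε) + ε ≈⟨ solve 2 (λ s e → (s :- e) :+ e := s :+ con (+ 0)) refl s ε ⟩
        s + 0#      ∎)))
      where
      below : ∀ v → (∃ λ n → v ≡ n · ε) → v ≤ s - ε
      below v (n , ≡.refl) = begin
        n · ε           ≈⟨ solve 2 (λ y e → y := (e :+ y) :- e) refl (n · ε) ε ⟩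
        (suc n · ε) - ε ≤⟨ +-mono-≤ (ub _ (suc n , ≡.refl)) ≤-refl ⟩
        s - ε           ∎

    -- Taking `ε` to be half of a positive gap `x - y` would bound the gap by its own half.
    ≤-by-approximation : ∀ {x y} → (∀ ε → 0# < ε → x ≤ y + ε) → x ≤ y
    ≤-by-approximation {x} {y} approx with em {x ≤ y}
    ... | yes x≤y = x≤y
    ... | no  x≰y with total x y
    ...   | inj₁ x≤y = x≤y
    ...   | inj₂ y≤x = ⊥-elim (<⇒≱ 0<gap (+-cancelˡ-≤ gap (begin
      gap + gap       ≤⟨ +-mono-≤ gap≤half gap≤half ⟩
      -- `2 · 1#` unfolds to `1# + (1# + 0#)`, hence the spelling of the constant.
      half + half     ≈⟨ solve 1 (λ h → h :+ h := (con (+ 1) :+ (con (+ 1) :+ con (+ 0))) :* h) refl half ⟩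
      2 · 1# * half   ≈⟨ x*[x⁻¹*y]≈y (0<suc·1 1) gap ⟩
      gap             ≈⟨ +-identityʳ gap ⟨
      gap + 0#        ∎)))
      where
      gap half : Carrier
      gap  = x - y
      half = (2 · 1#) ⁻¹ * gap
      0<gap : 0# < gap
      0<gap = 0<y-x (y≤x , λ y≈x → x≰y (≤-reflexive (sym y≈x)))
      gap≤half : gap ≤ half
      gap≤half = begin
        x - y            ≤⟨ +-mono-≤ (approx half (*-pos (0<x⁻¹ (0<suc·1 1)) 0<gap)) ≤-refl ⟩
        (y + half) - y   ≈⟨ solve 2 (λ y h → (y :+ h) :- y := h) refl y half ⟩
        half             ∎

    unbounded-growth : ∀ {ε} → 0# < ε → (f : ℕ → Carrier) → (∀ i → f i + ε ≤ f (suc i)) →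
                       ∀ b → ¬ (∀ i → f i ≤ b)
    -- The extra `ε` beyond the room `b - f 0` makes `f n` overshoot `b` strictly.
    unbounded-growth {ε} 0<ε f grows b f≤b with archimedean 0<ε (b - f 0 + ε)
    ... | n , gap≤ = <⇒≱ 0<ε (+-cancelˡ-≤ b (begin
      b + ε                   ≈⟨ solve 3 (λ b f e → b :+ e := f :+ (b :- f :+ e)) refl b (f 0) ε ⟩
      f 0 + (b - f 0 + ε)     ≤⟨ +-monoʳ-≤ _ gap≤ ⟩
      f 0 + n · ε             ≤⟨ growth f grows n ⟩
      f n                     ≤⟨ f≤b n ⟩
      b                       ≈⟨ +-identityʳ b ⟨
      b + 0#                  ∎))

-- Upper limits of running means.

module LimitSuperior (em : ExcludedMiddle 0ℓ) (ℝ : RealField) where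
  open OrderedField ℝ
  open ExtendedReals em ℝ

  ≤±[]-by-approximation : ∀ v {x} → (∀ ε → 0# < ε → v ≤± [ x + ε ]) → v ≤± [ x ]
  ≤±[]-by-approximation ⊥±    approx = ≤±.⊥±≤ _
  ≤±[]-by-approximation [ v ] approx =
    ≤±.[ ≤-by-approximation em (λ ε 0<ε → ≤±.[≤]-injective (approx ε 0<ε)) ]
  ≤±[]-by-approximation ⊤±    approx with approx 1# 0<1
  ... | ()

  []≤±-by-approximation : ∀ v {x} → (∀ ε → 0# < ε → [ x - ε ] ≤± v) → [ x ] ≤± v
  []≤±-by-approximation ⊥±    approx = ⊥-elim ([x]≰⊥ (approx 1# 0<1))
  []≤±-by-approximation [ v ] {x} approx =
    ≤±.[ ≤-by-approximation em (λ ε 0<ε → begin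
      x             ≈⟨ solve 2 (λ x e → x := (x :- e) :+ e) refl x ε ⟩
      (x - ε) + ε   ≤⟨ +-mono-≤ (≤±.[≤]-injective (approx ε 0<ε)) ≤-refl ⟩
      v + ε         ∎) ]
  []≤±-by-approximation ⊤±    approx = _ ≤±.≤⊤±

  inf-isInf : ∀ P → IsInf P (inf P)
  inf-isInf P = proj₂ (inf-exists P)

  sup-isSup : ∀ P → IsSup P (sup P)
  sup-isSup P = proj₂ (sup-exists P)

  limsup-≤ : ∀ a {x} → (∀ ε → 0# < ε → ∃ λ n → ∀ k → n ℕ.≤ k → a k ≤ x + ε) → limsup a ≤± [ x ]
  limsup-≤ a {x} eventually = ≤±[]-by-approximation (limsup a) λ ε 0<ε →
    let n , a≤ = eventually ε 0<ε in
    ≤±.≤±-trans ≤-trans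
      (proj₁ (inf-isInf _) _ (n , ≡.refl))
      (proj₂ (sup-isSup _) [ x + ε ] λ { _ (k , n≤k , ≡.refl) → ≤±.[ a≤ k n≤k ] })

  limsup-≥ : ∀ a {x} → (∀ ε → 0# < ε → ∃ λ n → ∀ k → n ℕ.≤ k → x - ε ≤ a k) → [ x ] ≤± limsup a
  limsup-≥ a {x} eventually = []≤±-by-approximation (limsup a) λ ε 0<ε →
    let n , a≥ = eventually ε 0<ε in
    proj₂ (inf-isInf _) [ x - ε ] λ { _ (m , ≡.refl) →
      -- The index `m ⊔ n` lies both in the tail from `m` on and in the range where the bound holds.
      ≤±.≤±-trans ≤-trans ≤±.[ a≥ (m ℕ.⊔ n) (ℕₚ.m≤n⊔m m n) ]
        (proj₁ (sup-isSup _) _ (m ℕ.⊔ n , ℕₚ.m≤m⊔n m n , ≡.refl)) }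

  -- The induction shifts `b` and `w` by one, because `sum` splits off its first term.
  telescope-≥ : ∀ n {γ} (b w : ℕ → Carrier) → (∀ k → γ + w k ≤ b k + w (suc k)) →
                n · γ + w 0 ≤ sum {n} (λ k → b (toℕ k)) + w n
  telescope-≥ zero    b w drift = ≤-refl
  telescope-≥ (suc n) {γ} b w drift = begin
    (γ + n · γ) + w 0       ≈⟨ solve 3 (λ g s w → (g :+ s) :+ w := s :+ (g :+ w)) refl γ (n · γ) (w 0) ⟩
    n · γ + (γ + w 0)       ≤⟨ +-monoʳ-≤ _ (drift 0) ⟩
    n · γ + (b 0 + w 1)     ≈⟨ solve 3 (λ s b w → s :+ (b :+ w) := b :+ (s :+ w)) refl (n · γ) (b 0) (w 1) ⟩
    b 0 + (n · γ + w 1)     ≤⟨ +-monoʳ-≤ _ (telescope-≥ n (λ k → b (suc k)) (λ k → w (suc k)) (λ k → drift (suc k))) ⟩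
    b 0 + (rest + w (suc n)) ≈⟨ solve 3 (λ b s w → b :+ (s :+ w) := (b :+ s) :+ w) refl (b 0) rest (w (suc n)) ⟩
    (b 0 + rest) + w (suc n) ∎
    where rest = sum {n} (λ k → b (suc (toℕ k)))

  telescope-≤ : ∀ n {γ} (b w : ℕ → Carrier) → (∀ k → b k + w (suc k) ≤ γ + w k) →
                sum {n} (λ k → b (toℕ k)) + w n ≤ n · γ + w 0
  telescope-≤ zero    b w drift = ≤-refl
  telescope-≤ (suc n) {γ} b w drift = begin
    (b 0 + rest) + w (suc n) ≈⟨ solve 3 (λ b s w → (b :+ s) :+ w := b :+ (s :+ w)) refl (b 0) rest (w (suc n)) ⟩
    b 0 + (rest + w (suc n)) ≤⟨ +-monoʳ-≤ _ (telescope-≤ n (λ k → b (suc k)) (λ k → w (suc k)) (λ k → drift (suc k))) ⟩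
    b 0 + (n · γ + w 1)     ≈⟨ solve 3 (λ s b w → b :+ (s :+ w) := s :+ (b :+ w)) refl (n · γ) (b 0) (w 1) ⟩
    n · γ + (b 0 + w 1)     ≤⟨ +-monoʳ-≤ _ (drift 0) ⟩
    n · γ + (γ + w 0)       ≈⟨ solve 3 (λ g s w → s :+ (g :+ w) := (g :+ s) :+ w) refl γ (n · γ) (w 0) ⟩
    (γ + n · γ) + w 0       ∎
    where rest = sum {n} (λ k → b (suc (toℕ k)))

  mean : (ℕ → Carrier) → ℕ → Carrier
  mean b n = (suc n · 1#) ⁻¹ * sum {suc n} (λ k → b (toℕ k))

  private
    suc·1-mean : ∀ b n → suc n · 1# * mean b n ≈ sum {suc n} (λ k → b (toℕ k))
    suc·1-mean b n = x*[x⁻¹*y]≈y (0<suc·1 n) _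

    overhead-vanishes : ∀ B {ε} → 0# < ε → ∃ λ n → ∀ k → n ℕ.≤ k → B ≤ suc k · ε
    overhead-vanishes B 0<ε =
      let n , B≤ = archimedean em 0<ε B in
      n , λ k n≤k → ≤-trans B≤ (·-monoˡ-≤ (proj₁ 0<ε) (ℕₚ.m≤n⇒m≤1+n n≤k))

  -- A fixed overhead vanishes in the mean. The bound has `n` copies of `γ` for `n + 1` costs, since
  -- drift inequalities say nothing about the cost at time 0; the missing copy is moved into the
  -- overhead, which becomes `B - γ`.
  limsup-mean-≤ : ∀ b {γ} B → (∀ n → sum {suc n} (λ k → b (toℕ k)) ≤ n · γ + B) →
                  limsup (mean b) ≤± [ γ ]
  limsup-mean-≤ b {γ} B bound = limsup-≤ (mean b) λ ε 0<ε →
    let n , B≤ = overhead-vanishes (B - γ) 0<ε in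
    n , λ k n≤k → *-cancelˡ-≤ (0<suc·1 k) (begin
      suc k · 1# * mean b k            ≈⟨ suc·1-mean b k ⟩
      sum {suc k} (λ i → b (toℕ i))    ≤⟨ bound k ⟩
      k · γ + B                        ≈⟨ solve 3 (λ s g B → s :+ B := (g :+ s) :+ (B :- g)) refl (k · γ) γ B ⟩
      suc k · γ + (B - γ)              ≤⟨ +-monoʳ-≤ _ (B≤ k n≤k) ⟩
      suc k · γ + suc k · ε            ≈⟨ +-cong (·1-* (suc k) γ) (·1-* (suc k) ε) ⟨
      suc k · 1# * γ + suc k · 1# * ε  ≈⟨ solve 3 (λ k g e → k :* g :+ k :* e := k :* (g :+ e)) refl (suc k · 1#) γ ε ⟩
      suc k · 1# * (γ + ε)             ∎)

  limsup-mean-≥ : ∀ b {γ} B → (∀ n → n · γ ≤ sum {suc n} (λ k → b (toℕ k)) + B) →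
                  [ γ ] ≤± limsup (mean b)
  limsup-mean-≥ b {γ} B bound = limsup-≥ (mean b) λ ε 0<ε →
    let n , B≤ = overhead-vanishes (B + γ) 0<ε in
    n , λ k n≤k → *-cancelˡ-≤ (0<suc·1 k) (begin
      suc k · 1# * (γ - ε)             ≈⟨ solve 3 (λ k g e → k :* (g :- e) := k :* g :- k :* e) refl (suc k · 1#) γ ε ⟩
      suc k · 1# * γ - suc k · 1# * ε  ≈⟨ +-cong (·1-* (suc k) γ) (-‿cong (·1-* (suc k) ε)) ⟩
      suc k · γ - suc k · ε            ≤⟨ ≤-by-gap (x≤y⇒0≤y-x (B≤ k n≤k))
                                            (solve 4 (λ s g e B → s :- B := (g :+ s :- e) :+ (e :- (B :+ g)))
                                              refl (k · γ) γ (suc k · ε) B) ⟩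
      k · γ - B                        ≤⟨ +-mono-≤ (bound k) ≤-refl ⟩
      (sum {suc k} (λ i → b (toℕ i)) + B) - B ≈⟨ solve 2 (λ s B → (s :+ B) :- B := s) refl _ B ⟩
      sum {suc k} (λ i → b (toℕ i))    ≈⟨ suc·1-mean b k ⟨
      suc k · 1# * mean b k            ∎)

-- Imbalance, depth and the threshold matching.

module Counting where
  open import Data.Nat.Base using (_+_; _∸_; _⊓_; _≤_)
  open ≡.≡-Reasoning

  -- (t - z)⁺, by truncated subtraction, for the imbalance z = x_{d₁} - x_{s₁}.
  -- Only the edge (1,2) changes z, so matching never decreases the depth.
  depth : ℕ → ℕ⁴ → ℕ
  depth t (vec d _ s _) = (t + s) ∸ d

  -- The proof stored in a state is irrelevant; decidable equality on ℕ recovers one that can be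
  -- used.
  balance : ∀ x → Balanced (counts x)
  balance (state x b) = recompute (_ ℕₚ.≟ _) b

  balanced-∸ : ∀ d d′ s s′ → Balanced (vec d d′ s s′) → d ∸ s ≡ s′ ∸ d′
  balanced-∸ d d′ s s′ b = begin
    d ∸ s               ≡⟨ ℕₚ.[m+n]∸[m+o]≡n∸o d′ d s ⟨
    (d′ + d) ∸ (d′ + s) ≡⟨ ≡.cong₂ _∸_ (≡.trans (ℕₚ.+-comm d′ d) b) (ℕₚ.+-comm d′ s) ⟩
    (s + s′) ∸ (s + d′) ≡⟨ ℕₚ.[m+n]∸[m+o]≡n∸o s s′ d′ ⟩
    s′ ∸ d′             ∎

  balanced-∸′ : ∀ d d′ s s′ → Balanced (vec d d′ s s′) → s ∸ d ≡ d′ ∸ s′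
  balanced-∸′ d d′ s s′ b = balanced-∸ s s′ d d′ (≡.sym b)

  depth∸t : ∀ t d s → ((t + s) ∸ d) ∸ t ≡ s ∸ d
  depth∸t t d s = begin
    ((t + s) ∸ d) ∸ t ≡⟨ ℕₚ.∸-+-assoc (t + s) d t ⟩
    (t + s) ∸ (d + t) ≡⟨ ≡.cong ((t + s) ∸_) (ℕₚ.+-comm d t) ⟩
    (t + s) ∸ (t + d) ≡⟨ ℕₚ.[m+n]∸[m+o]≡n∸o t s d ⟩
    s ∸ d             ∎

  t∸depth : ∀ t d s → d ≤ t + s → t ∸ ((t + s) ∸ d) ≡ d ∸ s
  t∸depth t d s d≤t+s = begin
    t ∸ j                 ≡⟨ ℕₚ.[m+n]∸[m+o]≡n∸o s t j ⟨
    (s + t) ∸ (s + j)     ≡⟨ ≡.cong₂ _∸_ (ℕₚ.+-comm s t) (ℕₚ.+-comm s j) ⟩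
    (t + s) ∸ (j + s)     ≡⟨ ℕₚ.∸-+-assoc (t + s) j s ⟨
    ((t + s) ∸ j) ∸ s     ≡⟨ ≡.cong (_∸ s) (ℕₚ.m∸[m∸n]≡n d≤t+s) ⟩
    d ∸ s                 ∎
    where j = (t + s) ∸ d

  -- This and the next three lemmas give the effect of each arrival pair on the depth. At depth 0
  -- the pair (1,2) has no effect, whence `pred`; the pair (2,1) needs `d ≤ t + s`, since beyond the
  -- threshold the truncated depth would stay 0.
  depth-11 : ∀ t d s → (t + (s + 1)) ∸ (d + 1) ≡ (t + s) ∸ d
  depth-11 t d s rewrite ≡.sym (ℕₚ.+-assoc t s 1) | ℕₚ.+-comm (t + s) 1 | ℕₚ.+-comm d 1 = ≡.refl

  depth-12 : ∀ t d s → (t + (s + 0)) ∸ (d + 1) ≡ pred ((t + s) ∸ d)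
  depth-12 t d s rewrite ℕₚ.+-identityʳ s | ℕₚ.+-comm d 1 = ≡.sym (ℕₚ.pred[m∸n]≡m∸[1+n] (t + s) d)

  depth-21 : ∀ t d s → d ≤ t + s → (t + (s + 1)) ∸ (d + 0) ≡ suc ((t + s) ∸ d)
  depth-21 t d s d≤t+s
    rewrite ≡.sym (ℕₚ.+-assoc t s 1) | ℕₚ.+-comm (t + s) 1 | ℕₚ.+-identityʳ d = ℕₚ.+-∸-assoc 1 d≤t+s

  depth-22 : ∀ t d s → (t + (s + 0)) ∸ (d + 0) ≡ (t + s) ∸ d
  depth-22 t d s rewrite ℕₚ.+-identityʳ s | ℕₚ.+-identityʳ d = ≡.refl

  -- The `u` pairs matched on (1,1) cancel from both counts; what remains is the removal of `v` more
  -- items of `d₁`, which can only raise the difference.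
  depth-match : ∀ t δ x → depth t (counts x) ≤ depth t (counts (match δ x))
  depth-match t δ x@(state (vec d d′ s s′) _)
    with rule δ x | feasible δ x
  ... | matching u v w | u+v≤d , _ , u≤s , _ = ℕₚ.≤-trans
    (ℕₚ.≤-reflexive (begin
      (t + s) ∸ d                     ≡⟨ ≡.cong₂ (λ s d → (t + s) ∸ d) (ℕₚ.m∸n+n≡m u≤s) (ℕₚ.m∸n+n≡m u≤d) ⟨
      (t + (s ∸ u + u)) ∸ (d ∸ u + u) ≡⟨ ≡.cong₂ _∸_ (≡.trans (≡.sym (ℕₚ.+-assoc t _ u)) (ℕₚ.+-comm _ u)) (ℕₚ.+-comm _ u) ⟩
      (u + (t + (s ∸ u))) ∸ (u + (d ∸ u)) ≡⟨ ℕₚ.[m+n]∸[m+o]≡n∸o u _ _ ⟩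
      (t + (s ∸ u)) ∸ (d ∸ u)         ∎))
    (ℕₚ.∸-monoʳ-≤ (t + (s ∸ u)) (ℕₚ.∸-monoʳ-≤ d (ℕₚ.m≤m+n u v)))
    where
    u≤d : u ≤ d
    u≤d = ℕₚ.≤-trans (ℕₚ.m≤m+n u v) u+v≤d

  thresholdMatching : ℕ → ℕ⁴ → Matching
  thresholdMatching t v = matching (v at D₁ ⊓ v at S₁) (excess Supremum.[ t ] v) (v at D₂ ⊓ v at S₂)

  private
    m⊓n+[m∸n]≡m : ∀ m n → m ⊓ n + (m ∸ n) ≡ m
    m⊓n+[m∸n]≡m m n = ≡.trans (≡.cong (_+ (m ∸ n)) (ℕₚ.⊓-comm m n)) (ℕₚ.m⊓n+n∸m≡n n m)

  thresholdRule : ℕ → DecisionRule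
  thresholdRule t = record
    { rule     = λ x → thresholdMatching t (counts x)
    ; feasible = λ x → thresholdFeasible x (balance x)
    }
    where
    thresholdFeasible : ∀ x → Balanced (counts x) → thresholdMatching t (counts x) ∈U x
    thresholdFeasible (state (vec d d′ s s′) _) b =
        ℕₚ.≤-trans (ℕₚ.+-monoʳ-≤ (d ⊓ s) (ℕₚ.m∸n≤m (d ∸ s) t))
          (ℕₚ.≤-reflexive (m⊓n+[m∸n]≡m d s))
      , ℕₚ.m⊓n≤m d′ s′
      , ℕₚ.m⊓n≤n d s
      -- By balance the surplus of `d₁` over `s₁` is that of `s₂` over `d₂`, so matching even all of
      -- it fits into `s₂`.
      , ℕₚ.≤-trans (ℕₚ.+-monoˡ-≤ (d′ ⊓ s′) (ℕₚ.m∸n≤m (d ∸ s) t))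
          (ℕₚ.≤-reflexive (begin
            (d ∸ s) + d′ ⊓ s′    ≡⟨ ≡.cong (_+ d′ ⊓ s′) (balanced-∸ d d′ s s′ b) ⟩
            (s′ ∸ d′) + d′ ⊓ s′  ≡⟨ ℕₚ.+-comm (s′ ∸ d′) _ ⟩
            d′ ⊓ s′ + (s′ ∸ d′)  ≡⟨ ℕₚ.m⊓n+n∸m≡n d′ s′ ⟩
            s′                   ∎))

  thresholdRule-isThreshold : ∀ t → IsThreshold (thresholdRule t)
  thresholdRule-isThreshold t = Supremum.[ t ] , λ x → ≡.refl

  private
    m∸[m⊓n]≡m∸n : ∀ m n → m ∸ m ⊓ n ≡ m ∸ n
    m∸[m⊓n]≡m∸n m n = ≡.trans (≡.cong (_∸ m ⊓ n) (≡.sym (m⊓n+[m∸n]≡m m n))) (ℕₚ.m+n∸m≡n (m ⊓ n) (m ∸ n))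

    m∸[m∸n]≡m⊓n : ∀ m n → m ∸ (m ∸ n) ≡ m ⊓ n
    m∸[m∸n]≡m⊓n m n = ≡.trans (≡.cong (_∸ (m ∸ n)) (≡.sym (m⊓n+[m∸n]≡m m n))) (ℕₚ.m+n∸n≡m (m ⊓ n) (m ∸ n))

    vec-cong : ∀ {a a′ b b′ c c′ d d′} → a ≡ a′ → b ≡ b′ → c ≡ c′ → d ≡ d′ →
               vec a b c d ≡ vec a′ b′ c′ d′
    vec-cong ≡.refl ≡.refl ≡.refl ≡.refl = ≡.refl

  -- In this form at most one of the pairs (1,2) and (2,1) of nodes is occupied, so the state is the
  -- cheapest one of its imbalance.
  match-thresholdRule : ∀ t x → let d = counts x at D₁ ; s = counts x at S₁ in
    counts (match (thresholdRule t) x) ≡ vec ((d ∸ s) ⊓ t) (s ∸ d) (s ∸ d) ((d ∸ s) ⊓ t)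
  match-thresholdRule t x@(state (vec d d′ s s′) _) = vec-cong left₁ left₂ left₃ left₄
    where
    b = balance x
    left₁ : d ∸ (d ⊓ s + ((d ∸ s) ∸ t)) ≡ (d ∸ s) ⊓ t
    left₁ = begin
      d ∸ (d ⊓ s + ((d ∸ s) ∸ t)) ≡⟨ ℕₚ.∸-+-assoc d (d ⊓ s) _ ⟨
      d ∸ d ⊓ s ∸ ((d ∸ s) ∸ t)   ≡⟨ ≡.cong (_∸ ((d ∸ s) ∸ t)) (m∸[m⊓n]≡m∸n d s) ⟩
      d ∸ s ∸ ((d ∸ s) ∸ t)       ≡⟨ m∸[m∸n]≡m⊓n (d ∸ s) t ⟩
      (d ∸ s) ⊓ t                 ∎
    left₂ : d′ ∸ d′ ⊓ s′ ≡ s ∸ d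
    left₂ = ≡.trans (m∸[m⊓n]≡m∸n d′ s′) (≡.sym (balanced-∸′ d d′ s s′ b))
    left₃ : s ∸ d ⊓ s ≡ s ∸ d
    left₃ = ≡.trans (≡.cong (s ∸_) (ℕₚ.⊓-comm d s)) (m∸[m⊓n]≡m∸n s d)
    left₄ : s′ ∸ (((d ∸ s) ∸ t) + d′ ⊓ s′) ≡ (d ∸ s) ⊓ t
    left₄ = begin
      s′ ∸ (((d ∸ s) ∸ t) + d′ ⊓ s′) ≡⟨ ≡.cong (s′ ∸_) (ℕₚ.+-comm _ (d′ ⊓ s′)) ⟩
      s′ ∸ (d′ ⊓ s′ + ((d ∸ s) ∸ t)) ≡⟨ ℕₚ.∸-+-assoc s′ (d′ ⊓ s′) _ ⟨
      s′ ∸ d′ ⊓ s′ ∸ ((d ∸ s) ∸ t)   ≡⟨ ≡.cong (λ z → s′ ∸ z ∸ ((d ∸ s) ∸ t)) (ℕₚ.⊓-comm d′ s′) ⟩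
      s′ ∸ s′ ⊓ d′ ∸ ((d ∸ s) ∸ t)   ≡⟨ ≡.cong (_∸ ((d ∸ s) ∸ t)) (m∸[m⊓n]≡m∸n s′ d′) ⟩
      s′ ∸ d′ ∸ ((d ∸ s) ∸ t)        ≡⟨ ≡.cong (_∸ ((d ∸ s) ∸ t)) (balanced-∸ d d′ s s′ b) ⟨
      d ∸ s ∸ ((d ∸ s) ∸ t)          ≡⟨ m∸[m∸n]≡m⊓n (d ∸ s) t ⟩
      (d ∸ s) ⊓ t                    ∎

  -- The rule uses (1,2) only for the excess over `t`, where the depth is 0 before and after. So the
  -- potential does not change and the drift of the threshold policy is an equality.
  depth-after-threshold : ∀ t d s → (t + (s ∸ d)) ∸ ((d ∸ s) ⊓ t) ≡ (t + s) ∸ d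
  depth-after-threshold t d s with ℕₚ.≤-total d s
  ... | inj₁ d≤s rewrite ℕₚ.m≤n⇒m∸n≡0 d≤s = ≡.sym (ℕₚ.+-∸-assoc t d≤s)
  ... | inj₂ s≤d rewrite ℕₚ.m≤n⇒m∸n≡0 s≤d = begin
    (t + 0) ∸ ((d ∸ s) ⊓ t)      ≡⟨ ≡.cong₂ _∸_ (ℕₚ.+-identityʳ t) (ℕₚ.⊓-comm (d ∸ s) t) ⟩
    t ∸ t ⊓ (d ∸ s)              ≡⟨ m∸[m⊓n]≡m∸n t (d ∸ s) ⟩
    t ∸ (d ∸ s)                  ≡⟨ ℕₚ.[m+n]∸[m+o]≡n∸o s t (d ∸ s) ⟨
    (s + t) ∸ (s + (d ∸ s))      ≡⟨ ≡.cong₂ _∸_ (ℕₚ.+-comm s t) (ℕₚ.m+[n∸m]≡n s≤d) ⟩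
    (t + s) ∸ d                  ∎

  one-sided : ∀ t d s → let m = (d ∸ s) ⊓ t ; n = s ∸ d in m ∸ n ≡ m × n ∸ m ≡ n
  one-sided t d s with ℕₚ.≤-total d s
  ... | inj₁ d≤s rewrite ℕₚ.m≤n⇒m∸n≡0 d≤s = ℕₚ.0∸n≡0 (s ∸ d) , ≡.refl
  ... | inj₂ s≤d rewrite ℕₚ.m≤n⇒m∸n≡0 s≤d = ≡.refl , ℕₚ.0∸n≡0 ((d ∸ s) ⊓ t)

-- Expectations over the arrivals.

module Model
  (em : ExcludedMiddle 0ℓ) (ℝ : RealField) (α β : RealField.Carrier ℝ)
  (0<α : RealField._<_ ℝ (RealField.0# ℝ) α) (α<1 : RealField._<_ ℝ α (RealField.1# ℝ))
  (0<β : RealField._<_ ℝ (RealField.0# ℝ) β) (β<1 : RealField._<_ ℝ β (RealField.1# ℝ))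
  (c : Node → RealField.Carrier ℝ) (0<c : ∀ k → RealField._<_ ℝ (RealField.0# ℝ) (c k))
  where
  open OrderedField ℝ
  open AverageCost em ℝ α β c using (Pr; 𝔼; cost; g)
  open LimitSuperior em ℝ
  open ExtendedReals em ℝ using (_≤±_)
  open CommutativeMonoidMult (CommutativeRing.+-commutativeMonoid commutativeRing)
    using (×-distrib-+)
  open Counting

  private
    0≤Pr : ∀ a → 0# ≤ Pr a
    0≤Pr (d₁ , s₁) = proj₁ (*-pos 0<α 0<β)
    0≤Pr (d₁ , s₂) = proj₁ (*-pos 0<α (0<y-x β<1))
    0≤Pr (d₂ , s₁) = proj₁ (*-pos (0<y-x α<1) 0<β)
    0≤Pr (d₂ , s₂) = proj₁ (*-pos (0<y-x α<1) (0<y-x β<1))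

  -- Written out so that `𝔼 (suc n)` unfolds to `𝔼₁` of expectations `𝔼 n`.
  𝔼₁ : (Arrival → Carrier) → Carrier
  𝔼₁ k = Pr (d₁ , s₁) * k (d₁ , s₁) + Pr (d₁ , s₂) * k (d₁ , s₂)
       + Pr (d₂ , s₁) * k (d₂ , s₁) + Pr (d₂ , s₂) * k (d₂ , s₂)

  𝔼₁-cong : ∀ {k l} → (∀ a → k a ≈ l a) → 𝔼₁ k ≈ 𝔼₁ l
  𝔼₁-cong k≈l = +-cong (+-cong (+-cong (*-congˡ (k≈l _)) (*-congˡ (k≈l _)))
                               (*-congˡ (k≈l _))) (*-congˡ (k≈l _))

  𝔼₁-mono : ∀ {k l} → (∀ a → k a ≤ l a) → 𝔼₁ k ≤ 𝔼₁ l
  𝔼₁-mono k≤l = +-mono-≤ (+-mono-≤ (+-mono-≤ (weigh _) (weigh _)) (weigh _)) (weigh _)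
    where weigh = λ a → *-monoʳ-≤ (0≤Pr a) (k≤l a)

  𝔼₁-+ : ∀ k l → 𝔼₁ (λ a → k a + l a) ≈ 𝔼₁ k + 𝔼₁ l
  𝔼₁-+ k l = solve 12
    (λ p q r s k₁ k₂ k₃ k₄ l₁ l₂ l₃ l₄ →
      p :* (k₁ :+ l₁) :+ q :* (k₂ :+ l₂) :+ r :* (k₃ :+ l₃) :+ s :* (k₄ :+ l₄) :=
      (p :* k₁ :+ q :* k₂ :+ r :* k₃ :+ s :* k₄) :+ (p :* l₁ :+ q :* l₂ :+ r :* l₃ :+ s :* l₄))
    refl _ _ _ _ _ _ _ _ _ _ _ _

  𝔼₁-const : ∀ x → 𝔼₁ (λ _ → x) ≈ x
  𝔼₁-const x = solve 3
    (λ a b x → a :* b :* x :+ a :* (con (+ 1) :- b) :* x :+ (con (+ 1) :- a) :* b :* x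
               :+ (con (+ 1) :- a) :* (con (+ 1) :- b) :* x := x)
    refl α β x

  𝔼-mono : ∀ n {f f′} → (∀ as → f as ≤ f′ as) → 𝔼 n f ≤ 𝔼 n f′
  𝔼-mono zero    f≤f′ = f≤f′ []
  𝔼-mono (suc n) f≤f′ = 𝔼₁-mono (λ a → 𝔼-mono n (λ as → f≤f′ (a ∷ as)))

  𝔼-+ : ∀ n f f′ → 𝔼 n (λ as → f as + f′ as) ≈ 𝔼 n f + 𝔼 n f′
  𝔼-+ zero    f f′ = refl
  𝔼-+ (suc n) f f′ = trans
    (𝔼₁-cong (λ a → 𝔼-+ n (λ as → f (a ∷ as)) (λ as → f′ (a ∷ as))))
    (𝔼₁-+ (λ a → 𝔼 n (λ as → f (a ∷ as))) (λ a → 𝔼 n (λ as → f′ (a ∷ as))))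

  𝔼-const : ∀ n x → 𝔼 n (λ _ → x) ≈ x
  𝔼-const zero    x = refl
  𝔼-const (suc n) x = trans (𝔼₁-cong (λ _ → 𝔼-const n x)) (𝔼₁-const x)

  𝔼-*ˡ : ∀ n x f → 𝔼 n (λ as → x * f as) ≈ x * 𝔼 n f
  𝔼-*ˡ zero    x f = refl
  𝔼-*ˡ (suc n) x f = trans (𝔼₁-cong (λ a → 𝔼-*ˡ n x (λ as → f (a ∷ as)))) (solve 9
    (λ p q r s x k₁ k₂ k₃ k₄ →
      p :* (x :* k₁) :+ q :* (x :* k₂) :+ r :* (x :* k₃) :+ s :* (x :* k₄) :=
      x :* (p :* k₁ :+ q :* k₂ :+ r :* k₃ :+ s :* k₄))
    refl _ _ _ _ _ _ _ _ _)

  -- Conditioning on the past: `𝔼` sums over the latest arrival outermost, whereas a drift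
  -- inequality averages over it with the earlier arrivals fixed.
  𝔼-𝔼₁ : ∀ n (f : Vec Arrival (suc n) → Carrier) →
         𝔼 n (λ as → 𝔼₁ (λ a → f (a ∷ as))) ≈ 𝔼 (suc n) f
  𝔼-𝔼₁ n f =
    trans (𝔼-+ n _ _) (+-cong
      (trans (𝔼-+ n _ _) (+-cong
        (trans (𝔼-+ n _ _) (+-cong (𝔼-*ˡ n _ _) (𝔼-*ˡ n _ _)))
        (𝔼-*ˡ n _ _)))
      (𝔼-*ˡ n _ _))

  contents : 𝒴 → ℕ⁴
  contents (q , a) = counts q ⊕ e₍ a ₎

  -- From drift inequalities to average costs.

  module _ (π : Policy) (y : 𝒴) where
    expectedCost : ℕ → Carrier
    expectedCost n = 𝔼 n (λ as → cost (Y π y n as))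

    module _ (Φ : 𝒴 → Carrier) where
      expectedPotential : ℕ → Carrier
      expectedPotential n = 𝔼 n (λ as → Φ (Y π y n as))

      private
        cost′ Φ′ : ∀ n → Vec Arrival n → Carrier
        cost′ n as = cost (Y π y n as)
        Φ′    n as = Φ (Y π y n as)

      expectedDrift-≥ : ∀ {γ} →
        (∀ δ y → γ + Φ y ≤ 𝔼₁ (λ a → cost (step δ y a) + Φ (step δ y a))) →
        ∀ n → γ + expectedPotential n ≤ expectedCost (suc n) + expectedPotential (suc n)
      expectedDrift-≥ {γ} drift n = begin
        γ + expectedPotential n                      ≈⟨ +-congʳ (𝔼-const n γ) ⟨
        𝔼 n (λ _ → γ) + expectedPotential n          ≈⟨ 𝔼-+ n (λ _ → γ) (Φ′ n) ⟨
        𝔼 n (λ as → γ + Φ (Y π y n as))              ≤⟨ 𝔼-mono n (λ as → drift (π n) (Y π y n as)) ⟩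
        𝔼 n (λ as → 𝔼₁ (λ a → cost′ (suc n) (a ∷ as) + Φ′ (suc n) (a ∷ as)))
                                                     ≈⟨ 𝔼-𝔼₁ n (λ as → cost′ (suc n) as + Φ′ (suc n) as) ⟩
        𝔼 (suc n) (λ as → cost′ (suc n) as + Φ′ (suc n) as)
                                                     ≈⟨ 𝔼-+ (suc n) (cost′ (suc n)) (Φ′ (suc n)) ⟩
        expectedCost (suc n) + expectedPotential (suc n) ∎

      expectedDrift-≤ : ∀ {γ} →
        (∀ n y → 𝔼₁ (λ a → cost (step (π n) y a) + Φ (step (π n) y a)) ≤ γ + Φ y) →
        ∀ n → expectedCost (suc n) + expectedPotential (suc n) ≤ γ + expectedPotential n
      expectedDrift-≤ {γ} drift n = begin
        expectedCost (suc n) + expectedPotential (suc n) ≈⟨ 𝔼-+ (suc n) (cost′ (suc n)) (Φ′ (suc n)) ⟨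
        𝔼 (suc n) (λ as → cost′ (suc n) as + Φ′ (suc n) as)
                                                     ≈⟨ 𝔼-𝔼₁ n (λ as → cost′ (suc n) as + Φ′ (suc n) as) ⟨
        𝔼 n (λ as → 𝔼₁ (λ a → cost′ (suc n) (a ∷ as) + Φ′ (suc n) (a ∷ as)))
                                                     ≤⟨ 𝔼-mono n (λ as → drift n (Y π y n as)) ⟩
        𝔼 n (λ as → γ + Φ (Y π y n as))              ≈⟨ 𝔼-+ n (λ _ → γ) (Φ′ n) ⟩
        𝔼 n (λ _ → γ) + expectedPotential n          ≈⟨ +-congʳ (𝔼-const n γ) ⟩
        γ + expectedPotential n                      ∎

      -- The drift inequalities telescope, and the final potential costs at most the overhead `B`.
      -- The cost at time 0 lies outside the telescope, so it is added and subtracted.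
      g-≥ : ∀ {γ} B → (∀ y → Φ y ≤ B) → (∀ y → 0# ≤ Φ y) →
        (∀ δ y → γ + Φ y ≤ 𝔼₁ (λ a → cost (step δ y a) + Φ (step δ y a))) →
        [ γ ] ≤± g π y
      g-≥ {γ} B Φ≤B 0≤Φ drift = limsup-mean-≥ expectedCost (B - expectedCost 0) λ n → begin
        n · γ                                     ≤⟨ x≤x+y (0≤Φ y) ⟩
        n · γ + Φ y                               ≤⟨ telescope-≥ n (λ k → expectedCost (suc k)) expectedPotential
                                                       (expectedDrift-≥ drift) ⟩
        later n + expectedPotential n             ≤⟨ +-monoʳ-≤ _ (𝔼-mono n (λ as → Φ≤B _)) ⟩
        later n + 𝔼 n (λ _ → B)                   ≈⟨ +-congˡ (𝔼-const n B) ⟩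
        later n + B                               ≈⟨ solve 3 (λ s B c → s :+ B := (c :+ s) :+ (B :- c)) refl
                                                       (later n) B (expectedCost 0) ⟩
        (expectedCost 0 + later n) + (B - expectedCost 0) ∎
        where later = λ n → sum {n} (λ k → expectedCost (suc (toℕ k)))

      -- Nonnegativity allows the final potential to be dropped, so `Φ` may be unbounded.
      g-≤ : ∀ {γ} → (∀ y → 0# ≤ Φ y) →
        (∀ n y → 𝔼₁ (λ a → cost (step (π n) y a) + Φ (step (π n) y a)) ≤ γ + Φ y) →
        g π y ≤± [ γ ]
      g-≤ {γ} 0≤Φ drift = limsup-mean-≤ expectedCost (Φ y + expectedCost 0) λ n → begin
        expectedCost 0 + later n                         ≤⟨ +-monoʳ-≤ _ (x≤x+y (begin
          0#                                               ≈⟨ 𝔼-const n 0# ⟨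
          𝔼 n (λ _ → 0#)                                   ≤⟨ 𝔼-mono n (λ as → 0≤Φ _) ⟩
          expectedPotential n                              ∎)) ⟩
        expectedCost 0 + (later n + expectedPotential n) ≤⟨ +-monoʳ-≤ _ (telescope-≤ n (λ k → expectedCost (suc k))
                                                              expectedPotential (expectedDrift-≤ drift)) ⟩
        expectedCost 0 + (n · γ + Φ y)                   ≈⟨ solve 3 (λ c s v → c :+ (s :+ v) := s :+ (v :+ c)) refl
                                                              (expectedCost 0) (n · γ) (Φ y) ⟩
        n · γ + (Φ y + expectedCost 0)                   ∎
        where later = λ n → sum {n} (λ k → expectedCost (suc (toℕ k)))

  -- Holding costs in terms of the imbalance.

  κ : ℕ⁴ → Carrier
  κ x = (x at D₁) · c D₁ + (x at D₂) · c D₂ + (x at S₁) · c S₁ + (x at S₂) · c S₂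

  κ-⊕ : ∀ x y → κ (x ⊕ y) ≈ κ x + κ y
  κ-⊕ (vec a a′ b b′) (vec k k′ l l′) = trans
    (+-cong (+-cong (+-cong (×-homo-+ _ a k) (×-homo-+ _ a′ k′)) (×-homo-+ _ b l)) (×-homo-+ _ b′ l′))
    (solve 8 (λ a k a′ k′ b l b′ l′ →
      (a :+ k) :+ (a′ :+ k′) :+ (b :+ l) :+ (b′ :+ l′) :=
      (a :+ a′ :+ b :+ b′) :+ (k :+ k′ :+ l :+ l′)) refl _ _ _ _ _ _ _ _)

  -- By balance each surplus item of `d₁` comes with one of `s₂`, and each of `s₁` with one of `d₂`;
  -- `C₊` and `C₋` are the costs of these pairs.
  C₊ C₋ p r arrivalCost : Carrier
  C₊ = c D₁ + c S₂
  C₋ = c S₁ + c D₂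
  p  = α * (1# - β)
  r  = (1# - α) * β
  arrivalCost = 𝔼₁ (λ a → κ e₍ a ₎)

  κ-one-sided : ∀ m n → κ (vec m n n m) ≈ m · C₊ + n · C₋
  κ-one-sided m n = trans
    (solve 4 (λ a b c d → a :+ b :+ c :+ d := (a :+ d) :+ (c :+ b)) refl _ _ _ _)
    (sym (+-cong (×-distrib-+ (c D₁) (c S₂) m) (×-distrib-+ (c S₁) (c D₂) n)))

  -- Every node holds at least its surplus over its partner in (1,1) or (2,2), and balance expresses
  -- the surpluses of `d₂` and `s₂` through `d` and `s`.
  κ-≥-imbalance : ∀ d d′ s s′ → Balanced (vec d d′ s s′) →
                  (d ℕ.∸ s) · C₊ + (s ℕ.∸ d) · C₋ ≤ κ (vec d d′ s s′)
  κ-≥-imbalance d d′ s s′ b = begin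
    (d ℕ.∸ s) · C₊ + (s ℕ.∸ d) · C₋                   ≈⟨ κ-one-sided (d ℕ.∸ s) (s ℕ.∸ d) ⟨
    κ (vec (d ℕ.∸ s) (s ℕ.∸ d) (s ℕ.∸ d) (d ℕ.∸ s))   ≤⟨ +-mono-≤ (+-mono-≤ (+-mono-≤
        (·-monoˡ-≤ (proj₁ (0<c D₁)) (ℕₚ.m∸n≤m d s))
        (·-monoˡ-≤ (proj₁ (0<c D₂)) (≡.subst (ℕ._≤ d′) (≡.sym (balanced-∸′ d d′ s s′ b)) (ℕₚ.m∸n≤m d′ s′))))
        (·-monoˡ-≤ (proj₁ (0<c S₁)) (ℕₚ.m∸n≤m s d)))
        (·-monoˡ-≤ (proj₁ (0<c S₂)) (≡.subst (ℕ._≤ s′) (≡.sym (balanced-∸ d d′ s s′ b)) (ℕₚ.m∸n≤m s′ d′))) ⟩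
    κ (vec d d′ s s′)                                 ∎

  0≤C₊ : 0# ≤ C₊
  0≤C₊ = +-nonneg (proj₁ (0<c D₁)) (proj₁ (0<c S₂))

  0≤C₋ : 0# ≤ C₋
  0≤C₋ = +-nonneg (proj₁ (0<c S₁)) (proj₁ (0<c D₂))

  -- The cost of the cheapest state with imbalance t - j.
  h : ℕ → ℕ → Carrier
  h t j = (t ℕ.∸ j) · C₊ + (j ℕ.∸ t) · C₋

  -- Potentials that depend on the depth.

  -- D j is the increment of the potential W from depth j - 1 to depth j; D 0 ≈ 0 accounts for
  -- arrivals at depth 0, which the threshold sends back to depth 0.
  module Potential (t : ℕ) (D : ℕ → Carrier) (D₀≈0 : D 0 ≈ 0#) where
    W : ℕ → Carrier
    W zero    = 0#
    W (suc j) = W j + D (suc j)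

    Φ : 𝒴 → Carrier
    Φ y = W (depth t (contents y))

    W-pred : ∀ j → W (pred j) ≈ W j - D j
    W-pred zero    = sym (trans (+-congˡ (-‿cong D₀≈0)) (solve 0 (con (+ 0) :- con (+ 0) := con (+ 0)) refl))
    W-pred (suc j) = solve 2 (λ w d → w := w :+ d :- d) refl (W j) (D (suc j))

    𝔼₁-split : ∀ x f → 𝔼₁ (λ a → κ (x ⊕ e₍ a ₎) + f a) ≈ κ x + arrivalCost + 𝔼₁ f
    𝔼₁-split x f = begin-equality
      𝔼₁ (λ a → κ (x ⊕ e₍ a ₎) + f a)   ≈⟨ 𝔼₁-+ (λ a → κ (x ⊕ e₍ a ₎)) f ⟩
      𝔼₁ (λ a → κ (x ⊕ e₍ a ₎)) + 𝔼₁ f  ≈⟨ +-congʳ (𝔼₁-cong (λ a → κ-⊕ x e₍ a ₎)) ⟩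
      𝔼₁ (λ a → κ x + κ e₍ a ₎) + 𝔼₁ f  ≈⟨ +-congʳ (𝔼₁-+ (λ _ → κ x) (λ a → κ e₍ a ₎)) ⟩
      𝔼₁ (λ _ → κ x) + arrivalCost + 𝔼₁ f ≈⟨ +-congʳ (+-congʳ (𝔼₁-const (κ x))) ⟩
      κ x + arrivalCost + 𝔼₁ f           ∎

    𝔼₁-W : ∀ d d′ s s′ → d ℕ.≤ t ℕ.+ s → let x = vec d d′ s s′ ; j = depth t x in
           𝔼₁ (λ a → W (depth t (x ⊕ e₍ a ₎))) ≈ W j - p * D j + r * D (suc j)
    𝔼₁-W d d′ s s′ d≤t+s = trans
      (+-cong (+-cong (+-cong (*-congˡ (W-cong (depth-11 t d s)))
                              (*-congˡ (trans (W-cong (depth-12 t d s)) (W-pred j))))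
                      (*-congˡ (W-cong (depth-21 t d s d≤t+s))))
              (*-congˡ (W-cong (depth-22 t d s))))
      (solve 5 (λ a b w u v →
        a :* b :* w :+ a :* (con (+ 1) :- b) :* (w :- u) :+ (con (+ 1) :- a) :* b :* (w :+ v)
          :+ (con (+ 1) :- a) :* (con (+ 1) :- b) :* w :=
        w :- a :* (con (+ 1) :- b) :* u :+ (con (+ 1) :- a) :* b :* v)
        refl α β (W j) (D j) (D (suc j)))
      where
      j = (t ℕ.+ s) ℕ.∸ d
      W-cong : ∀ {i k} → i ≡ k → W i ≈ W k
      W-cong ≡.refl = refl

    -- The hypothesis is the Poisson equation in terms of increments. It carries over to states
    -- because the threshold matching attains the cost `h` and preserves the depth.
    thresholdDrift : ∀ {γ} → (∀ j → h t j + r * D (suc j) ≈ γ + p * D j) →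
      ∀ y → 𝔼₁ (λ a → cost (step (thresholdRule t) y a) + Φ (step (thresholdRule t) y a))
            ≤ (γ + arrivalCost) + Φ y
    thresholdDrift {γ} balanced-drift (q , a) = ≤-reflexive (begin-equality
      𝔼₁ (λ a → κ (x′ ⊕ e₍ a ₎) + W (depth t (x′ ⊕ e₍ a ₎)))  ≈⟨ 𝔼₁-split x′ (λ a → W (depth t (x′ ⊕ e₍ a ₎))) ⟩
      κ x′ + arrivalCost + 𝔼₁ (λ a → W (depth t (x′ ⊕ e₍ a ₎)))
        ≈⟨ reflexive-at (match-thresholdRule t x) ⟩
      κ z + arrivalCost + 𝔼₁ (λ a → W (depth t (z ⊕ e₍ a ₎)))
        ≈⟨ +-cong (+-congʳ (κ-one-sided m n)) (𝔼₁-W m n n m m≤t+n) ⟩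
      m · C₊ + n · C₋ + arrivalCost + (W i - p * D i + r * D (suc i))
        ≈⟨ +-congʳ (+-congʳ (+-cong (×-congˡ (≡.sym m≡)) (×-congˡ (≡.sym n≡)))) ⟩
      h t i + arrivalCost + (W i - p * D i + r * D (suc i))
        ≈⟨ solve 5 (λ h A w u v → h :+ A :+ (w :- u :+ v) := (h :+ v) :+ A :+ (w :- u)) refl _ _ _ _ _ ⟩
      (h t i + r * D (suc i)) + arrivalCost + (W i - p * D i)
        ≈⟨ +-congʳ (+-congʳ (balanced-drift i)) ⟩
      (γ + p * D i) + arrivalCost + (W i - p * D i)
        ≈⟨ solve 4 (λ g u A w → (g :+ u) :+ A :+ (w :- u) := g :+ A :+ w) refl _ _ _ _ ⟩
      (γ + arrivalCost) + W i
        ≡⟨ ≡.cong (λ k → (γ + arrivalCost) + W k) (depth-after-threshold t d s) ⟩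
      (γ + arrivalCost) + W (depth t (counts x)) ∎)
      where
      x = q +ᵃ a
      x′ = counts (match (thresholdRule t) x)
      d s m n i : ℕ
      d = counts x at D₁
      s = counts x at S₁
      m = (d ℕ.∸ s) ℕ.⊓ t
      n = s ℕ.∸ d
      i = (t ℕ.+ n) ℕ.∸ m
      z = vec m n n m
      m≤t+n : m ℕ.≤ t ℕ.+ n
      m≤t+n = ℕₚ.≤-trans (ℕₚ.m⊓n≤n (d ℕ.∸ s) t) (ℕₚ.m≤m+n t n)
      m≡ : t ℕ.∸ i ≡ m
      m≡ = ≡.trans (t∸depth t m n m≤t+n) (proj₁ (one-sided t d s))
      n≡ : i ℕ.∸ t ≡ n
      n≡ = ≡.trans (depth∸t t m n) (proj₂ (one-sided t d s))
      reflexive-at : ∀ {x z} → x ≡ z →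
        κ x + arrivalCost + 𝔼₁ (λ a → W (depth t (x ⊕ e₍ a ₎))) ≈
        κ z + arrivalCost + 𝔼₁ (λ a → W (depth t (z ⊕ e₍ a ₎)))
      reflexive-at ≡.refl = refl

    module _ (0≤D : ∀ j → 0# ≤ D j) where
      W-mono : ∀ {i j} → i ℕ.≤ j → W i ≤ W j
      W-mono i≤j = go (ℕₚ.≤⇒≤′ i≤j)
        where
        go : ∀ {i j} → i ℕ.≤′ j → W i ≤ W j
        go ℕ.≤′-refl       = ≤-refl
        go (ℕ.≤′-step i≤j) = ≤-trans (go i≤j) (x≤x+y (0≤D _))

      W-nonneg : ∀ j → 0# ≤ W j
      W-nonneg j = W-mono {0} {j} ℕ.z≤n

      policyDrift : ∀ {γ} → (∀ j → γ + p * D j ≤ h t j + r * D (suc j)) → γ ≤ suc t · C₊ →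
        ∀ δ y → (γ + arrivalCost) + Φ y ≤ 𝔼₁ (λ a → cost (step δ y a) + Φ (step δ y a))
      policyDrift {γ} drift γ≤ δ (q , a) = begin
        -- Whatever the decision, the potential has not dropped, so it suffices to bound the drift
        -- from an arbitrary state after matching.
        (γ + arrivalCost) + W (depth t (counts x))  ≤⟨ +-monoʳ-≤ _ (W-mono (depth-match t δ x)) ⟩
        (γ + arrivalCost) + W (depth t (counts x′)) ≤⟨ from (counts x′) (balance x′) ⟩
        𝔼₁ (λ a → κ (counts x′ ⊕ e₍ a ₎) + W (depth t (counts x′ ⊕ e₍ a ₎))) ∎
        where
        x = q +ᵃ a
        x′ = match δ x
        from : ∀ x → Balanced x → (γ + arrivalCost) + W (depth t x) ≤
               𝔼₁ (λ a → κ (x ⊕ e₍ a ₎) + W (depth t (x ⊕ e₍ a ₎)))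
        from x@(vec d d′ s s′) b with ℕₚ.≤-<-connex d (t ℕ.+ s)
        ... | inj₁ d≤t+s = begin
          (γ + arrivalCost) + W j
            ≈⟨ solve 4 (λ g u A w → g :+ A :+ w := (g :+ u) :+ A :+ (w :- u)) refl _ (p * D j) _ _ ⟩
          (γ + p * D j) + arrivalCost + (W j - p * D j)
            ≤⟨ +-mono-≤ (+-mono-≤ (drift j) ≤-refl) ≤-refl ⟩
          (h t j + r * D (suc j)) + arrivalCost + (W j - p * D j)
            ≈⟨ solve 5 (λ h A w u v → (h :+ v) :+ A :+ (w :- u) := h :+ A :+ (w :- u :+ v)) refl _ _ _ _ _ ⟩
          h t j + arrivalCost + (W j - p * D j + r * D (suc j))
            ≈⟨ +-congʳ (+-congʳ (+-cong (×-congˡ (t∸depth t d s d≤t+s)) (×-congˡ (depth∸t t d s)))) ⟩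
          ((d ℕ.∸ s) · C₊ + (s ℕ.∸ d) · C₋) + arrivalCost + (W j - p * D j + r * D (suc j))
            ≤⟨ +-mono-≤ (+-mono-≤ (κ-≥-imbalance d d′ s s′ b) ≤-refl) ≤-refl ⟩
          κ x + arrivalCost + (W j - p * D j + r * D (suc j))
            ≈⟨ +-congˡ (𝔼₁-W d d′ s s′ d≤t+s) ⟨
          κ x + arrivalCost + 𝔼₁ (λ a → W (depth t (x ⊕ e₍ a ₎)))
            ≈⟨ 𝔼₁-split x (λ a → W (depth t (x ⊕ e₍ a ₎))) ⟨
          𝔼₁ (λ a → κ (x ⊕ e₍ a ₎) + W (depth t (x ⊕ e₍ a ₎))) ∎
          where j = (t ℕ.+ s) ℕ.∸ d
        -- Beyond the threshold `W` is zero and the imbalance is at least `t + 1`, so the holding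
        -- cost alone covers `γ`.
        ... | inj₂ t+s<d = begin
          (γ + arrivalCost) + W ((t ℕ.+ s) ℕ.∸ d)
            ≡⟨ ≡.cong (λ k → (γ + arrivalCost) + W k) (ℕₚ.m≤n⇒m∸n≡0 (ℕₚ.<⇒≤ t+s<d)) ⟩
          (γ + arrivalCost) + 0#
            ≤⟨ +-mono-≤ (+-mono-≤ γ≤κ ≤-refl) 0≤𝔼₁W ⟩
          κ x + arrivalCost + 𝔼₁ (λ a → W (depth t (x ⊕ e₍ a ₎)))
            ≈⟨ 𝔼₁-split x (λ a → W (depth t (x ⊕ e₍ a ₎))) ⟨
          𝔼₁ (λ a → κ (x ⊕ e₍ a ₎) + W (depth t (x ⊕ e₍ a ₎))) ∎
          where
          γ≤κ : γ ≤ κ x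
          γ≤κ = begin
            γ                               ≤⟨ γ≤ ⟩
            suc t · C₊                      ≤⟨ ·-monoˡ-≤ 0≤C₊ (ℕₚ.m+n≤o⇒m≤o∸n (suc t) t+s<d) ⟩
            (d ℕ.∸ s) · C₊                  ≤⟨ x≤x+y (·-nonneg (s ℕ.∸ d) 0≤C₋) ⟩
            (d ℕ.∸ s) · C₊ + (s ℕ.∸ d) · C₋ ≤⟨ κ-≥-imbalance d d′ s s′ b ⟩
            κ x                             ∎
          0≤𝔼₁W : 0# ≤ 𝔼₁ (λ a → W (depth t (x ⊕ e₍ a ₎)))
          0≤𝔼₁W = begin
            0#               ≈⟨ 𝔼₁-const 0# ⟨
            𝔼₁ (λ _ → 0#)    ≤⟨ 𝔼₁-mono (λ a → W-nonneg (depth t (x ⊕ e₍ a ₎))) ⟩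
            𝔼₁ (λ a → W (depth t (x ⊕ e₍ a ₎))) ∎

-- Mean costs of the thresholds and the choice of the best one.

module Optimality
  (em : ExcludedMiddle 0ℓ) (ℝ : RealField) (α β : RealField.Carrier ℝ)
  (0<α : RealField._<_ ℝ (RealField.0# ℝ) α) (α<1 : RealField._<_ ℝ α (RealField.1# ℝ))
  (0<β : RealField._<_ ℝ (RealField.0# ℝ) β) (β<1 : RealField._<_ ℝ β (RealField.1# ℝ))
  (β<α : RealField._<_ ℝ β α)
  (c : Node → RealField.Carrier ℝ) (0<c : ∀ k → RealField._<_ ℝ (RealField.0# ℝ) (c k))
  where
  open OrderedField ℝ
  open AverageCost em ℝ α β c using (g; g*)
  open LimitSuperior em ℝ
  open ExtendedReals em ℝ using (_≤±_; _≈±_; module ≤±)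
  open Counting

  open Model em ℝ α β 0<α α<1 0<β β<1 c 0<c

  private
    -- Also equal to `p - r`, the mean change of the imbalance by one arrival pair.
    ν : Carrier
    ν = α - β

    0<ν : 0# < ν
    0<ν = 0<y-x β<α

    0<p : 0# < p
    0<p = *-pos 0<α (0<y-x β<1)

    0<r : 0# < r
    0<r = *-pos (0<y-x α<1) 0<β

    0<C₊ : 0# < C₊
    0<C₊ = 0≤x⇒0<y⇒0<x+y (proj₁ (0<c D₁)) (0<c S₂)

    0<C₋ : 0# < C₋
    0<C₋ = 0≤x⇒0<y⇒0<x+y (proj₁ (0<c S₁)) (0<c D₂)

  -- Under threshold s the imbalance is s minus a geometric variable of ratio r / p, so the mean
  -- holding cost F₀ s solves p F₀(s) = (p - r) h(s) + r F₀(s - 1). F t j extends it to the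
  -- possibly negative threshold t - j.
  F₀ : ℕ → Carrier
  F₀ zero    = ν ⁻¹ * (r * C₋)
  F₀ (suc s) = p ⁻¹ * (ν * (suc s · C₊) + r * F₀ s)

  F : ℕ → ℕ → Carrier
  F t j = F₀ (t ℕ.∸ j) + (j ℕ.∸ t) · C₋

  F-recurrence : ∀ t j → p * F t j ≈ ν * h t j + r * F t (suc j)
  F-recurrence zero j rewrite ℕₚ.0∸n≡0 j = begin-equality
    p * (F₀ 0 + j · C₋)
      -- Expanding `p`, `r` and `ν` in `α` and `β` makes `p - r = ν` a polynomial identity.
      ≈⟨ solve 4 (λ a b k u → a :* (con (+ 1) :- b) :* (k :+ u) :=
           (a :- b) :* k :+ ((con (+ 1) :- a) :* b :* k :+ a :* (con (+ 1) :- b) :* u))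
           refl α β (F₀ 0) (j · C₋) ⟩
    ν * F₀ 0 + (r * F₀ 0 + p * (j · C₋))
      ≈⟨ +-congʳ (x*[x⁻¹*y]≈y 0<ν (r * C₋)) ⟩
    r * C₋ + (r * F₀ 0 + p * (j · C₋))
      ≈⟨ solve 5 (λ a b k u C → (con (+ 1) :- a) :* b :* C :+ ((con (+ 1) :- a) :* b :* k :+ a :* (con (+ 1) :- b) :* u) :=
           (a :- b) :* (con (+ 0) :+ u) :+ (con (+ 1) :- a) :* b :* (k :+ (C :+ u)))
           refl α β (F₀ 0) (j · C₋) C₋ ⟩
    ν * (0# + j · C₋) + r * (F₀ 0 + (C₋ + j · C₋)) ∎
  F-recurrence (suc t) zero rewrite ℕₚ.0∸n≡0 t = begin-equality
    p * (F₀ (suc t) + 0#)                        ≈⟨ *-congˡ (+-identityʳ _) ⟩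
    p * F₀ (suc t)                               ≈⟨ x*[x⁻¹*y]≈y 0<p _ ⟩
    ν * (suc t · C₊) + r * F₀ t                  ≈⟨ +-cong (*-congˡ (+-identityʳ _)) (*-congˡ (+-identityʳ _)) ⟨
    ν * (suc t · C₊ + 0#) + r * (F₀ t + 0#)      ∎
  -- `F` and `h` depend only on the difference of `t` and `j`, and truncated subtraction cancels the
  -- successors by computation.
  F-recurrence (suc t) (suc j) = F-recurrence t j

  -- As `p = ν + r`, `F₀ (suc s)` is a weighted average of `suc s · C₊` and `F₀ s`.
  F₀-descends : ∀ s → suc s · C₊ ≤ F₀ s → F₀ (suc s) ≤ F₀ s
  F₀-descends s le = *-cancelˡ-≤ 0<p (begin
    p * F₀ (suc s)              ≈⟨ x*[x⁻¹*y]≈y 0<p _ ⟩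
    ν * (suc s · C₊) + r * F₀ s ≤⟨ +-mono-≤ (*-monoʳ-≤ (proj₁ 0<ν) le) ≤-refl ⟩
    ν * F₀ s + r * F₀ s         ≈⟨ solve 3 (λ a b k → (a :- b) :* k :+ (con (+ 1) :- a) :* b :* k :=
                                     a :* (con (+ 1) :- b) :* k) refl α β (F₀ s) ⟩
    p * F₀ s                    ∎)

  F₀-antitone : ∀ t → (∀ i → i ℕ.< t → suc i · C₊ ≤ F₀ i) → ∀ {i} → i ℕ.≤ t → F₀ t ≤ F₀ i
  F₀-antitone t below i≤t = go (ℕₚ.≤⇒≤′ i≤t) ℕₚ.≤-refl
    where
    go : ∀ {i k} → i ℕ.≤′ k → k ℕ.≤ t → F₀ k ≤ F₀ i
    go ℕ.≤′-refl       k≤t = ≤-refl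
    go (ℕ.≤′-step {k} i≤k) k≤t = ≤-trans (F₀-descends k (below k k≤t)) (go i≤k (ℕₚ.<⇒≤ k≤t))

  -- Raising the threshold from `s` to `s + 1` pays while `suc s · C₊` is at most `F₀ s`. This must
  -- stop, as the former grows without bound and the latter decreases meanwhile.
  optimalThreshold : ∃ λ t → F₀ t ≤ suc t · C₊ × (∀ i → i ℕ.< t → suc i · C₊ ≤ F₀ i)
  optimalThreshold with archimedean em 0<C₊ (F₀ 0)
  ... | n , F₀0≤ with search (λ s → total (F₀ s) (suc s · C₊)) n
  ...   | inj₁ found = found
  -- If no crossing occurs before `n`, then `n` is one: `F₀ n ≤ F₀ 0 ≤ n · C₊`.
  ...   | inj₂ below = n , ≤-trans (F₀-antitone n below {0} ℕ.z≤n) (≤-trans F₀0≤ (x≤y+x 0≤C₊)) , below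

  -- The relative value function and the upper bound.

  module AtThreshold
    (t : ℕ) (top : F₀ t ≤ suc t · C₊) (below : ∀ i → i ℕ.< t → suc i · C₊ ≤ F₀ i)
    where

    F-min : ∀ j → F t 0 ≤ F t j
    F-min j rewrite ℕₚ.0∸n≡0 t =
      +-mono-≤ (F₀-antitone t below (ℕₚ.m∸n≤m t j)) (·-nonneg (j ℕ.∸ t) 0≤C₋)

    F-top : F t 0 ≤ suc t · C₊
    F-top rewrite ℕₚ.0∸n≡0 t = ≤-trans (≤-reflexive (+-identityʳ _)) top

    -- The increments of the relative value function of threshold t.
    D⁰ : ℕ → Carrier
    D⁰ j = ν ⁻¹ * (F t j - F t 0)

    D⁰-zero : D⁰ 0 ≈ 0#
    D⁰-zero = solve 2 (λ i x → i :* (x :- x) := con (+ 0)) refl (ν ⁻¹) (F t 0)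

    D⁰-nonneg : ∀ j → 0# ≤ D⁰ j
    D⁰-nonneg j = *-nonneg (0≤x⁻¹ 0<ν) (x≤y⇒0≤y-x (F-min j))

    -- Since `p = ν + r`, subtracting `F t 0` from `F` and `h` preserves `F-recurrence`; division by
    -- `ν` then gives the Poisson equation.
    D⁰-recurrence : ∀ j → h t j + r * D⁰ (suc j) ≈ F t 0 + p * D⁰ j
    D⁰-recurrence j = sym (begin-equality
      F t 0 + p * D⁰ j
        ≈⟨ solve 4 (λ g p i x → g :+ p :* (i :* (x :- g)) := g :+ (i :* (p :* x) :- i :* p :* g))
             refl (F t 0) p (ν ⁻¹) (F t j) ⟩
      F t 0 + (ν ⁻¹ * (p * F t j) - ν ⁻¹ * p * F t 0)
        ≈⟨ +-congˡ (+-congʳ (*-congˡ (F-recurrence t j))) ⟩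
      F t 0 + (ν ⁻¹ * (ν * h t j + r * F t (suc j)) - ν ⁻¹ * p * F t 0)
        ≈⟨ solve 6 (λ a b g i h y →
             g :+ (i :* ((a :- b) :* h :+ (con (+ 1) :- a) :* b :* y) :- i :* (a :* (con (+ 1) :- b)) :* g) :=
             g :+ (i :* ((a :- b) :* (h :- g)) :+ (con (+ 1) :- a) :* b :* (i :* (y :- g))))
             refl α β (F t 0) (ν ⁻¹) (h t j) (F t (suc j)) ⟩
      F t 0 + (ν ⁻¹ * (ν * (h t j - F t 0)) + r * D⁰ (suc j))
        ≈⟨ +-congˡ (+-congʳ (x⁻¹*[x*y]≈y 0<ν _)) ⟩
      F t 0 + (h t j - F t 0 + r * D⁰ (suc j))
        ≈⟨ solve 3 (λ g h x → g :+ (h :- g :+ x) := h :+ x) refl (F t 0) (h t j) (r * D⁰ (suc j)) ⟩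
      h t j + r * D⁰ (suc j) ∎)

    -- From depth `t` on the `F₀` term is frozen at `F₀ 0`. This linear rate is later compared with
    -- the growth of `D⁰ - D`.
    D⁰-increment : ∀ {j} → t ℕ.≤ j → D⁰ (suc j) ≈ D⁰ j + ν ⁻¹ * C₋
    D⁰-increment {j} t≤j
      rewrite ℕₚ.m≤n⇒m∸n≡0 t≤j | ℕₚ.m≤n⇒m∸n≡0 (ℕₚ.m≤n⇒m≤1+n t≤j) | ℕₚ.+-∸-assoc 1 t≤j =
      solve 5 (λ i k C u g → i :* (k :+ (C :+ u) :- g) := i :* (k :+ u :- g) :+ i :* C)
        refl (ν ⁻¹) (F₀ 0) C₋ ((j ℕ.∸ t) · C₋) (F t 0)

    optimalCost : Carrier
    optimalCost = F t 0 + arrivalCost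

    threshold-≤ : ∀ y → g (stationary (thresholdRule t)) y ≤± [ optimalCost ]
    threshold-≤ y = g-≤ (stationary (thresholdRule t)) y Φ (λ y → W-nonneg D⁰-nonneg (depth t (contents y)))
      (λ _ → thresholdDrift D⁰-recurrence)
      where open Potential t D⁰ D⁰-zero

    -- Bounded potentials and the lower bound for all policies.

    module Truncated (δ : Carrier) (0<δ : 0# < δ) where
      γ : Carrier
      γ = F t 0 - δ

      -- Taking positive parts preserves the drift inequality. Were D positive forever, D⁰ - D would
      -- grow faster than linearly while D⁰ grows linearly; so D vanishes from some depth on, and
      -- its potential is bounded.
      D : ℕ → Carrier
      D zero    = 0#
      D (suc j) = r ⁻¹ * (0# ⊔ (γ - h t j + p * D j))

      r*D : ∀ j → r * D (suc j) ≈ 0# ⊔ (γ - h t j + p * D j)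
      r*D j = x*[x⁻¹*y]≈y 0<r _

      D-nonneg : ∀ j → 0# ≤ D j
      D-nonneg zero    = ≤-refl
      D-nonneg (suc j) = *-nonneg (0≤x⁻¹ 0<r) (x≤x⊔y _ _)

      D-drift : ∀ j → γ + p * D j ≤ h t j + r * D (suc j)
      D-drift j = begin
        γ + p * D j                 ≈⟨ solve 3 (λ g h u → g :+ u := h :+ (g :- h :+ u)) refl γ (h t j) (p * D j) ⟩
        h t j + (γ - h t j + p * D j) ≤⟨ +-monoʳ-≤ _ (x≤y⊔x _ _) ⟩
        h t j + (0# ⊔ (γ - h t j + p * D j)) ≈⟨ +-congˡ (r*D j) ⟨
        h t j + r * D (suc j)       ∎

      r*D⁰ : ∀ j → r * D⁰ (suc j) ≈ F t 0 - h t j + p * D⁰ j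
      r*D⁰ j = begin-equality
        r * D⁰ (suc j)                    ≈⟨ solve 2 (λ h x → x := h :+ x :- h) refl (h t j) _ ⟩
        (h t j + r * D⁰ (suc j)) - h t j  ≈⟨ +-congʳ (D⁰-recurrence j) ⟩
        (F t 0 + p * D⁰ j) - h t j        ≈⟨ solve 3 (λ g u h → g :+ u :- h := g :- h :+ u) refl _ _ _ ⟩
        F t 0 - h t j + p * D⁰ j          ∎

      -- `D⁰` obeys the untruncated recursion with a larger constant and is nonnegative, so the
      -- positive part stays below it.
      D≤D⁰ : ∀ j → D j ≤ D⁰ j
      D≤D⁰ zero    = D⁰-nonneg 0
      D≤D⁰ (suc j) = *-cancelˡ-≤ 0<r (begin
        r * D (suc j)                   ≈⟨ r*D j ⟩
        0# ⊔ (γ - h t j + p * D j)      ≤⟨ ⊔-lub (*-nonneg (proj₁ 0<r) (D⁰-nonneg (suc j))) (begin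
          γ - h t j + p * D j             ≤⟨ +-mono-≤ (≤-by-gap (proj₁ 0<δ)
                                               (solve 3 (λ x d h → x :- h := x :- d :- h :+ d) refl (F t 0) δ (h t j)))
                                               (*-monoʳ-≤ (proj₁ 0<p) (D≤D⁰ j)) ⟩
          F t 0 - h t j + p * D⁰ j        ≈⟨ r*D⁰ j ⟨
          r * D⁰ (suc j)                  ∎) ⟩
        r * D⁰ (suc j)                  ∎)

      private
        cheap : ∃ λ n → γ ≤ n · C₋
        cheap = archimedean em 0<C₋ γ

        -- From depth `J` on the holding cost is at least `γ` and `D⁰` is linear.
        J : ℕ
        J = proj₁ cheap ℕ.+ t

        γ≤h : ∀ i → γ ≤ h t (i ℕ.+ J)
        γ≤h i = begin
          γ                               ≤⟨ proj₂ cheap ⟩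
          proj₁ cheap · C₋                ≤⟨ ·-monoˡ-≤ 0≤C₋ (ℕₚ.m+n≤o⇒m≤o∸n (proj₁ cheap) (ℕₚ.m≤n+m J i)) ⟩
          (i ℕ.+ J ℕ.∸ t) · C₋            ≤⟨ x≤y+x (·-nonneg (t ℕ.∸ (i ℕ.+ J)) 0≤C₊) ⟩
          h t (i ℕ.+ J)                   ∎

        t≤ : ∀ i → t ℕ.≤ i ℕ.+ J
        t≤ i = ℕₚ.≤-trans (ℕₚ.m≤n+m t (proj₁ cheap)) (ℕₚ.m≤n+m J i)

      module _ (D≉0 : ∀ i → ¬ (D (i ℕ.+ J) ≈ 0#)) where
        private
          E : ℕ → Carrier
          E i = D⁰ (i ℕ.+ J) - D (i ℕ.+ J)

          -- While `D` does not vanish, the maximum is its second argument; then `D` and `D⁰` follow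
          -- the same linear recursion with constants differing by `δ`.
          E-recurrence : ∀ i → r * E (suc i) ≈ δ + p * E i
          E-recurrence i = begin-equality
            r * E (suc i)                     ≈⟨ solve 3 (λ r x y → r :* (x :- y) := r :* x :- r :* y) refl r _ _ ⟩
            r * D⁰ (suc j) - r * D (suc j)    ≈⟨ +-cong (r*D⁰ j) (-‿cong positive) ⟩
            F t 0 - h t j + p * D⁰ j - (γ - h t j + p * D j)
              ≈⟨ solve 6 (λ f h p x d y → f :- h :+ p :* x :- (f :- d :- h :+ p :* y) := d :+ p :* (x :- y))
                   refl (F t 0) (h t j) p (D⁰ j) δ (D j) ⟩
            δ + p * E i ∎
            where
            j = i ℕ.+ J
            positive : r * D (suc j) ≈ γ - h t j + p * D j
            positive with ⊔-sel 0# (γ - h t j + p * D j)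
            ... | inj₁ ⊔≈0 = ⊥-elim (D≉0 (suc i) (trans (*-congˡ ⊔≈0) (zeroʳ _)))
            ... | inj₂ ⊔≈  = trans (r*D j) ⊔≈

          E-nonneg : ∀ i → 0# ≤ E i
          E-nonneg i = x≤y⇒0≤y-x (D≤D⁰ (i ℕ.+ J))

          E-grows : ∀ i → E i + r ⁻¹ * δ ≤ E (suc i)
          E-grows i = *-cancelˡ-≤ 0<r (begin
            r * (E i + r ⁻¹ * δ)       ≈⟨ solve 3 (λ r e x → r :* (e :+ x) := r :* e :+ r :* x) refl r (E i) _ ⟩
            r * E i + r * (r ⁻¹ * δ)   ≈⟨ +-congˡ (x*[x⁻¹*y]≈y 0<r δ) ⟩
            r * E i + δ                ≤⟨ ≤-by-gap (*-nonneg (proj₁ 0<ν) (E-nonneg i))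
                                            (solve 4 (λ a b e d → d :+ a :* (con (+ 1) :- b) :* e :=
                                              ((con (+ 1) :- a) :* b :* e :+ d) :+ (a :- b) :* e) refl α β (E i) δ) ⟩
            δ + p * E i                ≈⟨ E-recurrence i ⟨
            r * E (suc i)              ∎)

          -- The increment of `E` at `i` is `r ⁻¹ * (δ + ν * E i)`. Once `E` reaches `K`, this
          -- exceeds the increment `ν ⁻¹ * C₋` of `D⁰` by at least 1, so `D` falls by at least 1 per
          -- step.
          K : Carrier
          K = ν ⁻¹ * (r + r * (ν ⁻¹ * C₋))

          large : ∃ λ n → K ≤ n · (r ⁻¹ * δ)
          large = archimedean em (*-pos (0<x⁻¹ 0<r) 0<δ) K

          I : ℕ
          I = proj₁ large

          K≤E : ∀ i → K ≤ E (i ℕ.+ I)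
          K≤E i = begin
            K                                    ≤⟨ proj₂ large ⟩
            I · (r ⁻¹ * δ)                       ≤⟨ ·-monoˡ-≤ (proj₁ (*-pos (0<x⁻¹ 0<r) 0<δ)) (ℕₚ.m≤n+m I i) ⟩
            (i ℕ.+ I) · (r ⁻¹ * δ)               ≤⟨ x≤y+x (E-nonneg 0) ⟩
            E 0 + (i ℕ.+ I) · (r ⁻¹ * δ)         ≤⟨ growth E E-grows (i ℕ.+ I) ⟩
            E (i ℕ.+ I)                          ∎

          D′ : ℕ → Carrier
          D′ i = D (i ℕ.+ I ℕ.+ J)

          -D-grows : ∀ i → - D′ i + 1# ≤ - D′ (suc i)
          -D-grows i = *-cancelˡ-≤ 0<r (≤-by-gap
            (+-nonneg (proj₁ 0<δ) (x≤y⇒0≤y-x (≤-trans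
              (≤-reflexive (sym (x*[x⁻¹*y]≈y 0<ν _)))
              (*-monoʳ-≤ (proj₁ 0<ν) (K≤E i)))))
            (begin-equality
              r * - D (suc j)
                ≈⟨ solve 3 (λ r x y → r :* (:- y) := r :* (x :- y) :- r :* x) refl r (D⁰ (suc j)) (D (suc j)) ⟩
              r * E (suc (i ℕ.+ I)) - r * D⁰ (suc j)
                ≈⟨ +-cong (E-recurrence (i ℕ.+ I)) (-‿cong (*-congˡ (D⁰-increment (t≤ (i ℕ.+ I))))) ⟩
              δ + p * (D⁰ j - D j) - r * (D⁰ j + ν ⁻¹ * C₋)
                ≈⟨ solve 6 (λ a b d x y k →
                     d :+ a :* (con (+ 1) :- b) :* (x :- y) :- (con (+ 1) :- a) :* b :* (x :+ k) :=
                     (con (+ 1) :- a) :* b :* (:- y :+ con (+ 1)) :+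
                     (d :+ ((a :- b) :* (x :- y) :- ((con (+ 1) :- a) :* b :+ (con (+ 1) :- a) :* b :* k))))
                     refl α β δ (D⁰ j) (D j) (ν ⁻¹ * C₋) ⟩
              r * (- D j + 1#) + (δ + (ν * (D⁰ j - D j) - (r + r * (ν ⁻¹ * C₋)))) ∎))
            where j = i ℕ.+ I ℕ.+ J

        D-not-positive-forever : ⊥
        D-not-positive-forever = unbounded-growth em 0<1 (λ i → - D′ i) -D-grows 0#
          (λ i → 0≤y-x⇒x≤y (≤-trans (D-nonneg (i ℕ.+ I ℕ.+ J))
            (≤-reflexive (solve 1 (λ x → x := con (+ 0) :- :- x) refl _))))

      D-vanishes : ∃ λ i → D (i ℕ.+ J) ≈ 0#
      D-vanishes with em {∃ λ i → D (i ℕ.+ J) ≈ 0#}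
      ... | yes found = found
      ... | no  never = ⊥-elim (D-not-positive-forever (λ i D≈0 → never (i , D≈0)))

      open Potential t D refl

      private
        i₀ j₀ : ℕ
        i₀ = proj₁ D-vanishes
        j₀ = i₀ ℕ.+ J

      -- Beyond `J` the term `γ - h` is at most zero, so after a zero of `D` the positive part is
      -- zero again.
      D-stays-zero : ∀ k → D (k ℕ.+ j₀) ≈ 0#
      D-stays-zero zero    = proj₂ D-vanishes
      D-stays-zero (suc k) = trans (*-congˡ (antisym (⊔-lub ≤-refl ≤0) (x≤x⊔y _ _))) (zeroʳ _)
        where
        γ≤h′ : γ ≤ h t (k ℕ.+ j₀)
        γ≤h′ = ≡.subst (λ j → γ ≤ h t j) (ℕₚ.+-assoc k i₀ J) (γ≤h (k ℕ.+ i₀))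
        ≤0 : γ - h t (k ℕ.+ j₀) + p * D (k ℕ.+ j₀) ≤ 0#
        ≤0 = begin
          γ - h t (k ℕ.+ j₀) + p * D (k ℕ.+ j₀)  ≈⟨ +-congˡ (trans (*-congˡ (D-stays-zero k)) (zeroʳ p)) ⟩
          γ - h t (k ℕ.+ j₀) + 0#                ≤⟨ +-mono-≤ (+-mono-≤ γ≤h′ ≤-refl) ≤-refl ⟩
          h t (k ℕ.+ j₀) - h t (k ℕ.+ j₀) + 0#   ≈⟨ solve 1 (λ h → h :- h :+ con (+ 0) := con (+ 0)) refl _ ⟩
          0#                                     ∎

      W-constant : ∀ k → W (k ℕ.+ j₀) ≈ W j₀
      W-constant zero    = refl
      W-constant (suc k) = trans (+-cong (W-constant k) (D-stays-zero (suc k))) (+-identityʳ _)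

      W-bounded : ∀ j → W j ≤ W j₀
      W-bounded j with ℕₚ.≤-total j j₀
      ... | inj₁ j≤j₀ = W-mono D-nonneg {j} {j₀} j≤j₀
      ... | inj₂ j₀≤j = ≤-reflexive
        (≡.subst (λ j → W j ≈ W j₀) (ℕₚ.m∸n+n≡m j₀≤j) (W-constant (j ℕ.∸ j₀)))

      truncated-≥ : ∀ π y → [ γ + arrivalCost ] ≤± g π y
      truncated-≥ π y = g-≥ π y Φ (W j₀) (λ y → W-bounded (depth t (contents y))) (λ y → W-nonneg D-nonneg (depth t (contents y)))
        (policyDrift D-nonneg D-drift (begin
          F t 0 - δ           ≤⟨ ≤-by-gap (proj₁ 0<δ) (solve 2 (λ x d → x := x :- d :+ d) refl (F t 0) δ) ⟩
          F t 0               ≤⟨ F-top ⟩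
          suc t · C₊          ∎))

    policy-≥ : ∀ π y → [ optimalCost ] ≤± g π y
    policy-≥ π y = []≤±-by-approximation (g π y) λ ε 0<ε →
      ≤±.≤±-trans ≤-trans
        ≤±.[ ≤-reflexive (solve 3 (λ f A e → f :+ A :- e := f :- e :+ A) refl (F t 0) arrivalCost ε) ]
        (Truncated.truncated-≥ ε 0<ε π y)

    threshold-optimal : ∀ y → g (stationary (thresholdRule t)) y ≈± g* y
    threshold-optimal y = ≤±.≤±-antisym antisym
      (proj₂ (inf-isInf _) _ λ { _ (π , ≡.refl) →
        ≤±.≤±-trans ≤-trans (threshold-≤ y) (policy-≥ π y) })
      (proj₁ (inf-isInf _) _ (stationary (thresholdRule t) , ≡.refl))

theorem6 : (em : ExcludedMiddle 0ℓ) (ℝ : RealField) → let open RealField ℝ in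
    (α β : Carrier) → 0# < α → α < 1# → 0# < β → β < 1# → β < α →
    (c : Node → Carrier) → (∀ k → 0# < c k) →
    let open AverageCost em ℝ α β c in
    ∃ λ δ → IsThreshold δ × (∀ y → g (stationary δ) y ≈± g* y)
theorem6 em ℝ α β 0<α α<1 0<β β<1 β<α c 0<c =
  let t , top , below = optimalThreshold in
  thresholdRule t , thresholdRule-isThreshold t , AtThreshold.threshold-optimal t top below
  where
  open Counting
  open Optimality em ℝ α β 0<α α<1 0<β β<1 β<α c 0<c
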